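{- Let $A$ be a $W(k)$-algebra, let $e$ be a primitive idempotent of $Z_n$, let $V$ be a co-Whittaker $A[G_n]$-module in $e\mathrm{Rep}_{W(k)}(G_n)$, and fix an isomorphism $f:V^{(n)}\cong A$ of $A$-modules. Let $A'$ be a $W(k)$-subalgebra of $A$, and suppose that the composition $$\text{c-Ind}_{U_n}^{P_n}\psi_{A'}\to\text{c-Ind}_{U_n}^{P_n}\psi_A\to V\to\mathrm{Ind}_{U_n}^{G_n}\psi_A$$ has image contained in $\mathrm{Ind}_{U_n}^{G_n}\psi_{A'}$. Then the map $eZ_n\to A$ giving the action of $eZ_n$ on $V$ factors through $A'$.
   Context: $F$ is a $p$-adic field, $G_n=\mathrm{GL}_n(F)$, $k$ an algebraically closed field of characteristic $\ell\ne p$; all algebras are commutative. Fix a nontrivial smooth additive character $\psi:F\to W(k)^\times$. $U_n\subset G_n$ is the group of unipotent upper triangular matrices, with character $\psi(u)=\psi(u_{12}+\dots+u_{n-1,n})$; $P_n\subset G_n$ is the mirabolic subgroup of matrices with last row $(0,\dots,0,1)$. For a module $M$, $\psi_M$ is $M$ with $U_n$ acting through $\psi$. $\mathrm{Ind}$ (resp. $\text{c-Ind}$) is smooth (resp. compactly supported modulo $U_n$) induction, viewed as functions $h$ with $h(ug)=\psi(u)h(g)$ with the group acting by right translation. For a smooth $A[G_n]$-module $V$, $V^{(n)}=V/\langle uv-\psi(u)v\rangle_{u\in U_n,v\in V}$ ($\psi$-coinvariants; this also makes sense for smooth $A[P_n]$-modules). $V$ is co-Whittaker if (1) $V$ is admissible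 ($V^K$ is finitely generated over $A$ for every compact open $K$); (2) $V^{(n)}$ is free of rank one over $A$; (3) any quotient $W$ of $V$ with $W^{(n)}=0$ is zero. Then $\mathrm{End}_{A[G_n]}(V)=A$. $Z_n$ is the center (natural endomorphisms of the identity functor) of the category $\mathrm{Rep}_{W(k)}(G_n)$ of smooth $W(k)[G_n]$-modules; for a primitive idempotent $e$ of $Z_n$, $e\mathrm{Rep}_{W(k)}(G_n)$ is the full subcategory on which $e$ acts as the identity. For $V$ co-Whittaker in it, $eZ_n$ acts on $V$ through a map $eZ_n\to A$. Maps in the composition: the first is the inclusion. For the second, evaluation at the identity identifies $(\text{c-Ind}_{U_n}^{P_n}\psi_M)^{(n)}$ with $M$, and (Bernstein–Zelevinsky) there is a unique $A[P_n]$-homomorphism $\text{c-Ind}_{U_n}^{P_n}\psi_{V^{(n)}}\to V$ inducing the identity of $V^{(n)}$ on $\psi$-coinvariants; the second map is this one, with $V^{(n)}$ identified with $A$ by $f$. The third map sends $v$ to its Whittaker function $w_f(v):g\mapsto f(\overline{gv})$, where $\overline{gv}$ is the image of $gv$ in $V^{(n)}$. -}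

module Defs where

open import Level using (Level; 0ℓ; _⊔_) renaming (suc to lsuc)
open import Algebra.Bundles using (CommutativeMonoid; CommutativeRing; Group; Ring)
open import Algebra.Module.Bundles using (LeftModule)
open import Algebra.Module.Bundles.Raw using (RawLeftModule)
open import Algebra.Module.Morphism.Structures using (module LeftModuleMorphisms)
open import Algebra.Morphism.Bundles using (RingHomomorphism)
open import Data.Fin.Base using (Fin; zero; suc; toℕ; fromℕ; inject₁)
import Data.Fin.Base as Fin
open import Data.Integer.Base as ℤ using (ℤ; +_; -[1+_])
import Data.Integer.Properties as ℤₚ
open import Data.List.Base using (List; []; _++_)
open import Data.List.Relation.Unary.Any using (Any)
import Data.List.Relation.Unary.Any as Any
import Data.List.Relation.Unary.Any.Properties as Anyₚ
open import Data.Nat.Base as ℕ using (ℕ; zero; suc)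
import Data.Nat.Properties as ℕₚ
open import Data.Product.Base using (Σ; ∃; _×_; _,_; proj₁; proj₂)
open import Data.Sum.Base using (_⊎_; inj₁; inj₂)
open import Function.Base using (_∘_)
open import Function.Definitions using (Surjective)
open import Relation.Binary.PropositionalEquality.Core as ≡ using (_≡_)
open import Relation.Binary.Construct.Add.Supremum.NonStrict ℤ._≤_ as ℤ⁺ using (_≤⁺_; [_]; _≤⊤⁺)
open import Relation.Nullary.Construct.Add.Supremum using (_⁺; ⊤⁺; [_])
open import Relation.Nullary.Negation.Core using (¬_)
open import Relation.Unary using (Pred; _∈_; _∉_; _⊆_; _∪_; _∩_; ∅)

import Algebra.Module.Construct.TensorUnit as TensorUnit
import Algebra.Module.Morphism.LeftModuleMonomorphism as LeftModuleMono
import Algebra.Properties.CommutativeSemigroup as CSemigroupProps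
import Algebra.Properties.Group as GroupProps
import Algebra.Properties.Monoid.Mult as MonoidMult
import Algebra.Properties.Ring as RingProps
import Algebra.Properties.Semiring.Exp as SemiringExp
import Algebra.Properties.Semiring.Sum as SemiringSum
import Algebra.Properties.CommutativeMonoid.Sum as MonoidSum
import Relation.Binary.Reasoning.Setoid as SetoidReasoning

1ℓ : Level
1ℓ = lsuc 0ℓ

private
  variable
    a b c d ℓa ℓb ℓc ℓd : Level

CRing : Set₁
CRing = CommutativeRing 0ℓ 0ℓ

∣_∣ : CommutativeRing a ℓa → Set a
∣ R ∣ = CommutativeRing.Carrier R

-- The image of a natural number in a ring.
fromℕ# : (R : CommutativeRing a ℓa) → ℕ → ∣ R ∣
fromℕ# R n = n ⊠ 1#
  where open CommutativeRing R
        open MonoidMult +-monoid renaming (_×_ to _⊠_)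

RingHom : CommutativeRing a ℓa → CommutativeRing b ℓb → Set (a ⊔ b ⊔ ℓa ⊔ ℓb)
RingHom R S = RingHomomorphism (CommutativeRing.rawRing R) (CommutativeRing.rawRing S)

record IsField (R : CRing) : Set where
  open CommutativeRing R
  field
    1≉0     : 1# ≉ 0#
    inverse : ∀ x → x ≉ 0# → ∃ λ y → x * y ≈ 1#

record IsPrimitiveIdempotent (R : CommutativeRing a ℓa) (e : ∣ R ∣) : Set (a ⊔ ℓa) where
  open CommutativeRing R
  field
    idempotent : e * e ≈ e
    nonzero    : e ≉ 0#
    primitive′ : ∀ x y → x * x ≈ x → y * y ≈ y → x * y ≈ 0# → x + y ≈ e → x ≈ 0# ⊎ y ≈ 0#

-- The ring eR, whose unit is e; its elements are the z ∈ R with ez = z.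
cornerRing : (R : CommutativeRing a ℓa) (e : ∣ R ∣) → CommutativeRing._≈_ R (CommutativeRing._*_ R e e) e →
             CommutativeRing (a ⊔ ℓa) ℓa
cornerRing R e ee≈e = record
  { Carrier = Σ Carrier λ z → e * z ≈ z
  ; _≈_     = λ x y → proj₁ x ≈ proj₁ y
  ; _+_     = λ (x , ex) (y , ey) → x + y , trans (distribˡ e x y) (+-cong ex ey)
  ; _*_     = λ (x , ex) (y , ey) → x * y , trans (sym (*-assoc e x y)) (*-congʳ ex)
  ; -_      = λ (x , ex) → - x , trans (sym (-‿distribʳ-* e x)) (-‿cong ex)
  ; 0#      = 0# , zeroʳ e
  ; 1#      = e , ee≈e
  ; isCommutativeRing = record
    { isRing = record
      { +-isAbelianGroup = record
        { isGroup = record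
          { isMonoid = record
            { isSemigroup = record
              { isMagma = record
                { isEquivalence = record { refl = refl ; sym = sym ; trans = trans }
                ; ∙-cong = +-cong }
              ; assoc = λ _ _ _ → +-assoc _ _ _ }
            ; identity = (λ _ → +-identityˡ _) , (λ _ → +-identityʳ _) }
          ; inverse = (λ _ → -‿inverseˡ _) , (λ _ → -‿inverseʳ _)
          ; ⁻¹-cong = -‿cong }
        ; comm = λ _ _ → +-comm _ _ }
      ; *-cong     = *-cong
      ; *-assoc    = λ _ _ _ → *-assoc _ _ _
      ; *-identity = proj₂ , (λ (x , ex) → trans (*-comm x e) ex)
      ; distrib    = (λ _ _ _ → distribˡ _ _ _) , (λ _ _ _ → distribʳ _ _ _) }
    ; *-comm = λ _ _ → *-comm _ _ } }
  where open CommutativeRing R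
        open RingProps ring using (-‿distribʳ-*)

-- Algebraically closed fields of characteristic ℓ (used only for ℓ prime).
record AlgebraicallyClosedField (ℓ : ℕ) : Set₁ where
  field
    ring           : CRing
    isField        : IsField ring
  open CommutativeRing ring hiding (ring; zero) public
  open SemiringExp semiring using (_^_)
  open SemiringSum semiring using (sum)
  field
    characteristic : fromℕ# ring ℓ ≈ 0#
    root           : ∀ d (a : Fin (suc d) → Carrier) →
                     ∃ λ x → x ^ suc d + sum (λ i → a i * x ^ toℕ i) ≈ 0#

-- W(k) for k perfect of characteristic ℓ, as the strict ℓ-ring with residue
-- ring k: it is ℓ-torsion free, ℓ-adically separated and complete, with
-- W(k)/ℓ ≅ k.  These properties determine W(k) up to unique isomorphism.
record WittVectors (ℓ : ℕ) (k : AlgebraicallyClosedField ℓ) : Set₁ where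
  private module k = AlgebraicallyClosedField k
  field
    ring    : CRing
    residue : RingHom ring k.ring
  open CommutativeRing ring hiding (ring; zero) public
  open SemiringExp semiring using (_^_)
  open RingHomomorphism residue using (⟦_⟧)

  ℓ^_∣_ : ℕ → Carrier → Set
  ℓ^ n ∣ x = ∃ λ y → x ≈ fromℕ# ring ℓ ^ n * y

  field
    residue-surjective : Surjective _≈_ k._≈_ ⟦_⟧
    residue-kernel     : ∀ x → ⟦ x ⟧ k.≈ k.0# → ℓ^ 1 ∣ x
    torsionFree        : ∀ x → fromℕ# ring ℓ * x ≈ 0# → x ≈ 0#
    separated          : ∀ x → (∀ n → ℓ^ n ∣ x) → x ≈ 0#
    complete           : (s : ℕ → Carrier) → (∀ n → ℓ^ n ∣ (s (suc n) - s n)) →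
                         ∃ λ x → ∀ n → ℓ^ n ∣ (x - s n)

infixl 6 _+⁺_
_+⁺_ : ℤ ⁺ → ℤ ⁺ → ℤ ⁺
[ i ] +⁺ [ j ] = [ i ℤ.+ j ]
[ _ ] +⁺ ⊤⁺    = ⊤⁺
⊤⁺    +⁺ _     = ⊤⁺

-- Finite extensions of ℚₚ, as the complete discretely valued fields of
-- characteristic 0 with finite residue field of characteristic p.
-- The valuation is normalised, with v 0 = ⊤⁺ = ∞.
record PAdicField (p : ℕ) : Set₁ where
  field
    ring    : CRing
    isField : IsField ring
  open CommutativeRing ring hiding (ring; zero) public

  field
    v : Carrier → ℤ ⁺

  infix 4 _∈𝔭^_
  _∈𝔭^_ : Carrier → ℤ → Set
  x ∈𝔭^ m = [ m ] ≤⁺ v x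

  field
    v-cong          : ∀ {x y} → x ≈ y → v x ≡ v y
    v-0#            : v 0# ≡ ⊤⁺
    v-⊤⁺            : ∀ {x} → v x ≡ ⊤⁺ → x ≈ 0#
    v-*             : ∀ x y → v (x * y) ≡ v x +⁺ v y
    v-+             : ∀ {m} x y → x ∈𝔭^ m → y ∈𝔭^ m → x + y ∈𝔭^ m
    uniformizer     : ∃ λ ϖ → v ϖ ≡ [ + 1 ]
    characteristic0 : ∀ n → fromℕ# ring n ≈ 0# → n ≡ 0
    residueChar     : fromℕ# ring p ∈𝔭^ + 1
    residueFinite   : ∃ λ (rs : List Carrier) → ∀ x → x ∈𝔭^ + 0 → Any (λ r → x - r ∈𝔭^ + 1) rs
    complete        : (s : ℕ → Carrier) →
                      (∀ m → ∃ λ N → ∀ i j → N ℕ.≤ i → N ℕ.≤ j → s i - s j ∈𝔭^ + m) →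
                      ∃ λ x → ∀ m → ∃ λ N → ∀ i → N ℕ.≤ i → s i - x ∈𝔭^ + m

  ∈𝔭-resp : ∀ {m x y} → x ≈ y → x ∈𝔭^ m → y ∈𝔭^ m
  ∈𝔭-resp {m} x≈y = ≡.subst ([ m ] ≤⁺_) (v-cong x≈y)

  0∈𝔭 : ∀ {m x} → x ≈ 0# → x ∈𝔭^ m
  0∈𝔭 {m} x≈0 = ≡.subst ([ m ] ≤⁺_) (≡.sym (≡.trans (v-cong x≈0) v-0#)) ([ m ] ≤⊤⁺)

  ∈𝔭-mono : ∀ {m n x} → m ℤ.≤ n → x ∈𝔭^ n → x ∈𝔭^ m
  ∈𝔭-mono m≤n = ℤ⁺.≤⁺-trans ℤₚ.≤-trans [ m≤n ]

  *-∈𝔭 : ∀ {m n x y} → x ∈𝔭^ m → y ∈𝔭^ n → x * y ∈𝔭^ (m ℤ.+ n)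
  *-∈𝔭 {m} {n} {x} {y} p q = ≡.subst ([ m ℤ.+ n ] ≤⁺_) (≡.sym (v-* x y)) (go p q)
    where
    go : ∀ {i j} → [ m ] ≤⁺ i → [ n ] ≤⁺ j → [ m ℤ.+ n ] ≤⁺ i +⁺ j
    go [ p ]        [ q ]     = [ ℤₚ.+-mono-≤ p q ]
    go [ p ]        (_ ≤⊤⁺)   = _ ≤⊤⁺
    go (_ ≤⊤⁺)      q         = _ ≤⊤⁺

  bounded : ∀ x → ∃ λ n → x ∈𝔭^ (ℤ.- + n)
  bounded x with v x
  ... | ⊤⁺        = 0 , (_ ≤⊤⁺)
  ... | [ + n ]      = 0 , [ ℤ.+≤+ ℕ.z≤n ]
  ... | [ -[1+ n ] ] = suc n , [ ℤₚ.≤-refl ]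

  cancel-∈𝔭ʳ : ∀ {m n x y} → x ∈𝔭^ + (m ℕ.+ n) → y ∈𝔭^ (ℤ.- + n) → x * y ∈𝔭^ + m
  cancel-∈𝔭ʳ {m} {n} {x} {y} p q = ≡.subst (x * y ∈𝔭^_) eq (*-∈𝔭 p q)
    where
    eq : + (m ℕ.+ n) ℤ.+ ℤ.- + n ≡ + m
    eq = ≡.trans (≡.cong (ℤ._+ ℤ.- + n) (ℤₚ.pos-+ m n))
        (≡.trans (ℤₚ.+-assoc (+ m) (+ n) (ℤ.- + n))
        (≡.trans (≡.cong (λ z → + m ℤ.+ z) (ℤₚ.+-inverseʳ (+ n))) (ℤₚ.+-identityʳ (+ m))))

  cancel-∈𝔭ˡ : ∀ {m n x y} → x ∈𝔭^ (ℤ.- + n) → y ∈𝔭^ + (m ℕ.+ n) → x * y ∈𝔭^ + m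
  cancel-∈𝔭ˡ p q = ∈𝔭-resp (*-comm _ _) (cancel-∈𝔭ʳ q p)

  open SemiringSum semiring using (sum)

  sum-∈𝔭 : ∀ {m n} (f : Fin n → Carrier) → (∀ i → f i ∈𝔭^ m) → sum f ∈𝔭^ m
  sum-∈𝔭 {n = zero}  f h = 0∈𝔭 refl
  sum-∈𝔭 {n = suc n} f h = v-+ _ _ (h zero) (sum-∈𝔭 (f ∘ suc) (h ∘ suc))

  boundedFamily : ∀ {n} (f : Fin n → Carrier) → ∃ λ b → ∀ i → f i ∈𝔭^ (ℤ.- + b)
  boundedFamily {zero}  f = 0 , λ ()
  boundedFamily {suc n} f =
    let b₀ , h₀ = bounded (f zero)
        b₁ , h₁ = boundedFamily (f ∘ suc)
    in b₀ ℕ.⊔ b₁ , λ where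
      zero    → ∈𝔭-mono (ℤₚ.neg-mono-≤ (ℤ.+≤+ (ℕₚ.m≤m⊔n b₀ b₁))) h₀
      (suc i) → ∈𝔭-mono (ℤₚ.neg-mono-≤ (ℤ.+≤+ (ℕₚ.m≤n⊔m b₀ b₁))) (h₁ i)

-- A module over a commutative ring.
Mod : CRing → ∀ c → Set (1ℓ ⊔ lsuc c)
Mod R c = LeftModule (CommutativeRing.ring R) c 0ℓ

module ModuleLemmas {R : Ring 0ℓ 0ℓ} (M : LeftModule R c 0ℓ) where
  open Ring R using (-_; 1#; -‿inverseʳ)
  open LeftModule M
  open CSemigroupProps (CommutativeMonoid.commutativeSemigroup +ᴹ-commutativeMonoid) public
    using (interchange)
  open GroupProps +ᴹ-group public
    using () renaming (inverseʳ-unique to -ᴹ-unique; ε⁻¹≈ε to -ᴹ0≈0; ⁻¹-involutive to -ᴹ-involutive)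

  *ₗ--ᴹ : ∀ r x → r *ₗ (-ᴹ x) ≈ᴹ -ᴹ (r *ₗ x)
  *ₗ--ᴹ r x = -ᴹ-unique (r *ₗ x) (r *ₗ (-ᴹ x))
    (≈ᴹ-trans (≈ᴹ-sym (*ₗ-distribˡ r x (-ᴹ x)))
    (≈ᴹ-trans (*ₗ-congˡ (-ᴹ‿inverseʳ x)) (*ₗ-zeroʳ r)))

  -ᴹ-+ : ∀ x y → -ᴹ (x +ᴹ y) ≈ᴹ -ᴹ x +ᴹ -ᴹ y
  -ᴹ-+ x y = ≈ᴹ-sym (-ᴹ-unique (x +ᴹ y) (-ᴹ x +ᴹ -ᴹ y)
    (≈ᴹ-trans (interchange x y (-ᴹ x) (-ᴹ y))
    (≈ᴹ-trans (+ᴹ-cong (-ᴹ‿inverseʳ x) (-ᴹ‿inverseʳ y)) (+ᴹ-identityˡ 0ᴹ))))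

  -1*ₗ : ∀ x → (- 1#) *ₗ x ≈ᴹ -ᴹ x
  -1*ₗ x = -ᴹ-unique x _
    (≈ᴹ-trans (+ᴹ-cong (≈ᴹ-sym (*ₗ-identityˡ x)) ≈ᴹ-refl)
    (≈ᴹ-trans (≈ᴹ-sym (*ₗ-distribʳ x _ _))
    (≈ᴹ-trans (*ₗ-congʳ (-‿inverseʳ 1#)) (*ₗ-zeroˡ x))))

record LinearMap {R : Ring 0ℓ 0ℓ} (M : LeftModule R c 0ℓ) (N : LeftModule R d 0ℓ) : Set (c ⊔ d) where
  private
    module M = LeftModule M
    module N = LeftModule N
  open LeftModuleMorphisms M.rawLeftModule N.rawLeftModule
  field
    ⟦_⟧   : M.Carrierᴹ → N.Carrierᴹ
    isHom : IsLeftModuleHomomorphism ⟦_⟧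
  open IsLeftModuleHomomorphism isHom public

mkLinearMap : {R : Ring 0ℓ 0ℓ} (M : LeftModule R c 0ℓ) (N : LeftModule R d 0ℓ) →
  let module M = LeftModule M ; module N = LeftModule N in
  (h : M.Carrierᴹ → N.Carrierᴹ) →
  (∀ {x y} → x M.≈ᴹ y → h x N.≈ᴹ h y) →
  (∀ x y → h (x M.+ᴹ y) N.≈ᴹ h x N.+ᴹ h y) →
  (∀ r x → h (r M.*ₗ x) N.≈ᴹ r N.*ₗ h x) →
  LinearMap M N
mkLinearMap {R = R} M N h h-cong h-+ h-* = record
  { ⟦_⟧   = h
  ; isHom = record
    { +ᴹ-isGroupHomomorphism = record
      { isMonoidHomomorphism = record
        { isMagmaHomomorphism = record
          { isRelHomomorphism = record { cong = h-cong } ; homo = h-+ }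
        ; ε-homo = h-0 }
      ; ⁻¹-homo = λ x → GroupProps.inverseʳ-unique N.+ᴹ-group (h x) (h (M.-ᴹ x))
          (N.≈ᴹ-trans (N.≈ᴹ-sym (h-+ x (M.-ᴹ x))) (N.≈ᴹ-trans (h-cong (M.-ᴹ‿inverseʳ x)) h-0)) }
    ; *ₗ-homo = h-* } }
  where
  module R = Ring R
  module M = LeftModule M
  module N = LeftModule N
  h-0 : h M.0ᴹ N.≈ᴹ N.0ᴹ
  h-0 = N.≈ᴹ-trans (h-cong (M.≈ᴹ-sym (M.*ₗ-zeroˡ M.0ᴹ)))
       (N.≈ᴹ-trans (h-* R.0# M.0ᴹ) (N.*ₗ-zeroˡ _))

record LinearIso {R : Ring 0ℓ 0ℓ} (M : LeftModule R c 0ℓ) (N : LeftModule R d 0ℓ) : Set (c ⊔ d) where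
  private
    module M = LeftModule M
    module N = LeftModule N
  open LeftModuleMorphisms M.rawLeftModule N.rawLeftModule
  field
    ⟦_⟧   : M.Carrierᴹ → N.Carrierᴹ
    isIso : IsLeftModuleIsomorphism ⟦_⟧
  open IsLeftModuleIsomorphism isIso public

  ⟦_⟧⁻¹ : N.Carrierᴹ → M.Carrierᴹ
  ⟦ y ⟧⁻¹ = proj₁ (surjective y)

  inverse-≈ : ∀ y → ⟦ ⟦ y ⟧⁻¹ ⟧ N.≈ᴹ y
  inverse-≈ y = proj₂ (surjective y) M.≈ᴹ-refl

  inverse : LinearMap N M
  inverse = mkLinearMap N M ⟦_⟧⁻¹
    (λ {x} {y} x≈y → injective (≈-via x (N.≈ᴹ-trans x≈y (N.≈ᴹ-sym (inverse-≈ y)))))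
    (λ x y → injective (≈-via _ (N.≈ᴹ-sym
      (N.≈ᴹ-trans (+ᴹ-homo _ _) (N.+ᴹ-cong (inverse-≈ x) (inverse-≈ y))))))
    (λ r x → injective (≈-via _ (N.≈ᴹ-sym
      (N.≈ᴹ-trans (*ₗ-homo _ _) (N.*ₗ-congˡ (inverse-≈ x))))))
    where
    ≈-via : ∀ x {z} → x N.≈ᴹ z → ⟦ ⟦ x ⟧⁻¹ ⟧ N.≈ᴹ z
    ≈-via x = N.≈ᴹ-trans (inverse-≈ x)

regular : (R : CRing) → Mod R 0ℓ
regular R = TensorUnit.leftModule

record Algebra (W : CRing) : Set₁ where
  field
    ring      : CRing
    structure : RingHom W ring
  open CommutativeRing ring hiding (ring; zero) public
  open RingHomomorphism structure public
    using () renaming (⟦_⟧ to η; ⟦⟧-cong to η-cong; +-homo to η-+; *-homo to η-*; 0#-homo to η-0#; 1#-homo to η-1#)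

record Subalgebra {W : CRing} (A : Algebra W) : Set₁ where
  open Algebra A
  field
    member  : Pred Carrier 0ℓ
    resp    : ∀ {x y} → x ≈ y → x ∈ member → y ∈ member
    +-mem   : ∀ {x y} → x ∈ member → y ∈ member → x + y ∈ member
    *-mem   : ∀ {x y} → x ∈ member → y ∈ member → x * y ∈ member
    η-mem   : ∀ w → η w ∈ member

  0-mem : 0# ∈ member
  0-mem = resp η-0# (η-mem _)

  1-mem : 1# ∈ member
  1-mem = resp η-1# (η-mem _)

  neg-mem : ∀ {x} → x ∈ member → - x ∈ member
  neg-mem {x} m = resp (trans (*-congʳ (RingHomomorphism.-‿homo structure W.1#))
                       (trans (*-congʳ (-‿cong η-1#))
                       (trans (sym (RingProps.-‿distribˡ-* (CommutativeRing.ring ring) 1# x))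
                              (-‿cong (*-identityˡ x)))))
                       (*-mem (η-mem (W.- W.1#)) m)
    where module W = CommutativeRing W

  subring : CRing
  subring = record
    { Carrier = Σ Carrier member
    ; _≈_     = λ x y → proj₁ x ≈ proj₁ y
    ; _+_     = λ (x , p) (y , q) → x + y , +-mem p q
    ; _*_     = λ (x , p) (y , q) → x * y , *-mem p q
    ; -_      = λ (x , p) → - x , neg-mem p
    ; 0#      = 0# , 0-mem
    ; 1#      = 1# , 1-mem
    ; isCommutativeRing = record
      { isRing = record
        { +-isAbelianGroup = record
          { isGroup = record
            { isMonoid = record
              { isSemigroup = record
                { isMagma = record
                  { isEquivalence = record { refl = refl ; sym = sym ; trans = trans }
                  ; ∙-cong = +-cong }
                ; assoc = λ _ _ _ → +-assoc _ _ _ }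
              ; identity = (λ _ → +-identityˡ _) , (λ _ → +-identityʳ _) }
            ; inverse = (λ _ → -‿inverseˡ _) , (λ _ → -‿inverseʳ _)
            ; ⁻¹-cong = -‿cong }
          ; comm = λ _ _ → +-comm _ _ }
        ; *-cong     = *-cong
        ; *-assoc    = λ _ _ _ → *-assoc _ _ _
        ; *-identity = (λ _ → *-identityˡ _) , (λ _ → *-identityʳ _)
        ; distrib    = (λ _ _ _ → distribˡ _ _ _) , (λ _ _ _ → distribʳ _ _ _) }
      ; *-comm = λ _ _ → *-comm _ _ } }

  algebra : Algebra W
  algebra = record
    { ring      = subring
    ; structure = record
      { ⟦_⟧ = λ w → η w , η-mem w
      ; isRingHomomorphism = record
        { isSemiringHomomorphism = record
          { isNearSemiringHomomorphism = record
            { +-isMonoidHomomorphism = record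
              { isMagmaHomomorphism = record
                { isRelHomomorphism = record { cong = η-cong } ; homo = η-+ }
              ; ε-homo = η-0# }
            ; *-homo = η-* }
          ; 1#-homo = η-1# }
        ; -‿homo = RingHomomorphism.-‿homo structure } } }

module _ {W : CRing} (A : Algebra W) where
  private module A = Algebra A

  restrictScalars : Mod A.ring c → Mod W c
  restrictScalars M = record
    { Carrierᴹ = Carrierᴹ
    ; _≈ᴹ_ = _≈ᴹ_
    ; _+ᴹ_ = _+ᴹ_
    ; _*ₗ_ = λ w x → A.η w *ₗ x
    ; 0ᴹ   = 0ᴹ
    ; -ᴹ_  = -ᴹ_
    ; isLeftModule = record
      { isLeftSemimodule = record
        { +ᴹ-isCommutativeMonoid = +ᴹ-isCommutativeMonoid
        ; isPreleftSemimodule = record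
          { *ₗ-cong      = λ p q → *ₗ-cong (A.η-cong p) q
          ; *ₗ-zeroˡ     = λ x → ≈ᴹ-trans (*ₗ-congʳ A.η-0#) (*ₗ-zeroˡ x)
          ; *ₗ-distribʳ  = λ x r s → ≈ᴹ-trans (*ₗ-congʳ (A.η-+ r s)) (*ₗ-distribʳ x _ _)
          ; *ₗ-identityˡ = λ x → ≈ᴹ-trans (*ₗ-congʳ A.η-1#) (*ₗ-identityˡ x)
          ; *ₗ-assoc     = λ r s x → ≈ᴹ-trans (*ₗ-congʳ (A.η-* r s)) (*ₗ-assoc _ _ x)
          ; *ₗ-zeroʳ     = λ r → *ₗ-zeroʳ _
          ; *ₗ-distribˡ  = λ r → *ₗ-distribˡ _ } }
      ; -ᴹ‿cong    = -ᴹ‿cong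
      ; -ᴹ‿inverse = -ᴹ‿inverse } }
    where open LeftModule M

  restrictLinear : {M : Mod A.ring c} {N : Mod A.ring d} →
                   LinearMap M N → LinearMap (restrictScalars M) (restrictScalars N)
  restrictLinear {M = M} {N} h = mkLinearMap (restrictScalars M) (restrictScalars N)
    ⟦_⟧ ⟦⟧-cong +ᴹ-homo (λ w → *ₗ-homo (A.η w))
    where open LinearMap h

-- A homomorphism of W-modules, A′ and A being regarded as W-modules.
inclusion : {W : CRing} {A : Algebra W} (A′ : Subalgebra A) →
            LinearMap (restrictScalars (Subalgebra.algebra A′) (regular (Subalgebra.subring A′)))
                      (restrictScalars A (regular (Algebra.ring A)))
inclusion {A = A} A′ = mkLinearMap
  (restrictScalars (Subalgebra.algebra A′) (regular (Subalgebra.subring A′)))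
  (restrictScalars A (regular (Algebra.ring A)))
  proj₁ (λ p → p) (λ _ _ → refl) (λ _ _ → refl)
  where open Algebra A

-- Nontrivial smooth characters F → W^×.  The values are units because
-- ψ x * ψ (- x) ≈ ψ 0 ≈ 1.
record AdditiveCharacter {p : ℕ} (F : PAdicField p) (W : CRing) : Set where
  private
    module F = PAdicField F
    module W = CommutativeRing W
  field
    ψ          : F.Carrier → W.Carrier
    ψ-cong     : ∀ {x y} → x F.≈ y → ψ x W.≈ ψ y
    ψ-0        : ψ F.0# W.≈ W.1#
    ψ-+        : ∀ x y → ψ (x F.+ y) W.≈ ψ x W.* ψ y
    smooth     : ∃ λ m → ∀ x → x F.∈𝔭^ m → ψ x W.≈ W.1#
    nontrivial : ∃ λ x → ¬ ψ x W.≈ W.1#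

module LinearGroups {p : ℕ} (F : PAdicField p) where
  open PAdicField F
  open SemiringSum semiring
    using (sum; sum-cong-≋; *-distribˡ-sum; *-distribʳ-sum; ∑-comm; sum-replicate-zero)
  private module ≈-R = SetoidReasoning setoid

  Matrix : ℕ → Set
  Matrix n = Fin n → Fin n → Carrier

  infix 4 _≈ₘ_
  _≈ₘ_ : ∀ {n} → Matrix n → Matrix n → Set
  x ≈ₘ y = ∀ i j → x i j ≈ y i j

  infixl 7 _*ₘ_
  _*ₘ_ : ∀ {n} → Matrix n → Matrix n → Matrix n
  (x *ₘ y) i j = sum λ l → x i l * y l j

  1ₘ : ∀ {n} → Matrix n
  1ₘ zero    zero    = 1#
  1ₘ zero    (suc j) = 0#
  1ₘ (suc i) zero    = 0#
  1ₘ (suc i) (suc j) = 1ₘ i j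

  sum-zero : ∀ {n} (f : Fin n → Carrier) → (∀ i → f i ≈ 0#) → sum f ≈ 0#
  sum-zero {n} f h = trans (sum-cong-≋ h) (sum-replicate-zero n)

  1ₘ-sumˡ : ∀ {n} i (f : Fin n → Carrier) → sum (λ l → 1ₘ i l * f l) ≈ f i
  1ₘ-sumˡ zero    f = trans (+-cong (*-identityˡ _) (sum-zero (λ l → 0# * f (suc l)) λ _ → zeroˡ _)) (+-identityʳ _)
  1ₘ-sumˡ (suc i) f = trans (+-cong (zeroˡ _) (1ₘ-sumˡ i (f ∘ suc))) (+-identityˡ _)

  1ₘ-sumʳ : ∀ {n} j (f : Fin n → Carrier) → sum (λ l → f l * 1ₘ l j) ≈ f j
  1ₘ-sumʳ zero    f = trans (+-cong (*-identityʳ _) (sum-zero (λ l → f (suc l) * 0#) λ _ → zeroʳ _)) (+-identityʳ _)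
  1ₘ-sumʳ (suc j) f = trans (+-cong (zeroʳ _) (1ₘ-sumʳ j (f ∘ suc))) (+-identityˡ _)

  *ₘ-cong : ∀ {n} {x x′ y y′ : Matrix n} → x ≈ₘ x′ → y ≈ₘ y′ → x *ₘ y ≈ₘ x′ *ₘ y′
  *ₘ-cong p q i j = sum-cong-≋ λ l → *-cong (p i l) (q l j)

  *ₘ-identityˡ : ∀ {n} (x : Matrix n) → 1ₘ *ₘ x ≈ₘ x
  *ₘ-identityˡ x i j = 1ₘ-sumˡ i (λ l → x l j)

  *ₘ-identityʳ : ∀ {n} (x : Matrix n) → x *ₘ 1ₘ ≈ₘ x
  *ₘ-identityʳ x i j = 1ₘ-sumʳ j (x i)

  *ₘ-assoc : ∀ {n} (x y z : Matrix n) → (x *ₘ y) *ₘ z ≈ₘ x *ₘ (y *ₘ z)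
  *ₘ-assoc x y z i j = begin
    sum (λ l → sum (λ r → x i r * y r l) * z l j)    ≈⟨ sum-cong-≋ (λ l → *-distribʳ-sum (z l j) (λ r → x i r * y r l)) ⟩
    sum (λ l → sum (λ r → x i r * y r l * z l j))    ≈⟨ ∑-comm (λ l r → x i r * y r l * z l j) ⟩
    sum (λ r → sum (λ l → x i r * y r l * z l j))    ≈⟨ sum-cong-≋ (λ r → sum-cong-≋ λ l → *-assoc (x i r) (y r l) (z l j)) ⟩
    sum (λ r → sum (λ l → x i r * (y r l * z l j)))  ≈⟨ sum-cong-≋ (λ r → *-distribˡ-sum (x i r) (λ l → y r l * z l j)) ⟨
    sum (λ r → x i r * sum (λ l → y r l * z l j))    ∎
    where open ≈-R

  ≈ₘ-refl : ∀ {n} {x : Matrix n} → x ≈ₘ x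
  ≈ₘ-refl i j = refl

  ≈ₘ-sym : ∀ {n} {x y : Matrix n} → x ≈ₘ y → y ≈ₘ x
  ≈ₘ-sym p i j = sym (p i j)

  ≈ₘ-trans : ∀ {n} {x y z : Matrix n} → x ≈ₘ y → y ≈ₘ z → x ≈ₘ z
  ≈ₘ-trans p q i j = trans (p i j) (q i j)

  -- A group together with a faithful representation by n × n matrices, whose
  -- topology is the one induced by Fⁿˣⁿ.
  record LinearGroup (n : ℕ) : Set₁ where
    field
      group : Group 0ℓ 0ℓ
    open Group group public
      using (_∙_; ε; _⁻¹; assoc; identityˡ; identityʳ; inverseˡ; inverseʳ; ∙-cong; ∙-congˡ; ∙-congʳ; ⁻¹-cong)
      renaming (Carrier to Elem; _≈_ to _≈ᴳ_; refl to reflᴳ; sym to symᴳ; trans to transᴳ)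
    field
      matrix           : Elem → Matrix n
      matrix-cong      : ∀ {g h} → g ≈ᴳ h → matrix g ≈ₘ matrix h
      matrix-injective : ∀ {g h} → matrix g ≈ₘ matrix h → g ≈ᴳ h
      matrix-ε         : matrix ε ≈ₘ 1ₘ
      matrix-∙         : ∀ g h → matrix (g ∙ h) ≈ₘ matrix g *ₘ matrix h

    Near : ℕ → Elem → Elem → Set
    Near m g h = ∀ i j → matrix h i j - matrix g i j ∈𝔭^ + m

    IsOpen : Pred Elem 0ℓ → Set
    IsOpen S = ∀ g → g ∈ S → ∃ λ m → ∀ h → Near m g h → h ∈ S

    -- The image of S in H\G is compact, in terms of covers by H-stable open sets.
    IsCompactModulo : Pred Elem 0ℓ → Pred Elem 0ℓ → Set₁
    IsCompactModulo H S =
      ∀ {I : Set} (O : I → Pred Elem 0ℓ) →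
      (∀ i → IsOpen (O i)) →
      (∀ i u g → u ∈ H → g ∈ O i → u ∙ g ∈ O i) →
      (∀ g → g ∈ S → ∃ λ i → g ∈ O i) →
      ∃ λ (is : List I) → ∀ g → g ∈ S → Any (λ i → g ∈ O i) is

    IsCompact : Pred Elem 0ℓ → Set₁
    IsCompact = IsCompactModulo (_≈ᴳ ε)

    record IsCompactOpenSubgroup (K : Pred Elem 0ℓ) : Set₁ where
      field
        resp    : ∀ {g h} → g ≈ᴳ h → g ∈ K → h ∈ K
        ε∈      : ε ∈ K
        ∙∈      : ∀ {g h} → g ∈ K → h ∈ K → g ∙ h ∈ K
        ⁻¹∈     : ∀ {g} → g ∈ K → g ⁻¹ ∈ K
        open′   : IsOpen K
        compact : IsCompact K

    Near-≈ : ∀ {m g h} → g ≈ᴳ h → Near m g h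
    Near-≈ {g = g} {h} g≈h i j =
      0∈𝔭 (trans (+-congʳ (sym (matrix-cong g≈h i j))) (-‿inverseʳ _))

    open-resp : ∀ {S} → IsOpen S → ∀ {g h} → g ≈ᴳ h → g ∈ S → h ∈ S
    open-resp o {g} {h} g≈h s = proj₂ (o g s) h (Near-≈ g≈h)

    private
      difference-*ʳ : ∀ x y z → x * z - y * z ≈ (x - y) * z
      difference-*ʳ x y z = trans (+-congˡ (RingProps.-‿distribˡ-* (CommutativeRing.ring ring) y z)) (sym (distribʳ z x (- y)))

      difference-*ˡ : ∀ x y z → z * x - z * y ≈ z * (x - y)
      difference-*ˡ x y z = trans (+-congˡ (RingProps.-‿distribʳ-* (CommutativeRing.ring ring) z y)) (sym (distribˡ z x (- y)))

      sum-difference : ∀ {n} (f g : Fin n → Carrier) → sum f - sum g ≈ sum (λ i → f i - g i)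
      sum-difference {zero}  f g = -‿inverseʳ 0#
      sum-difference {suc n} f g =
        trans (+-congˡ (sym (RingProps.-‿+-comm (CommutativeRing.ring ring) _ _)))
       (trans (CSemigroupProps.interchange (CommutativeMonoid.commutativeSemigroup +-commutativeMonoid) _ _ _ _)
              (+-congˡ (sum-difference (f ∘ suc) (g ∘ suc))))

      bound : (x : Matrix n) → ∃ λ b → ∀ i j → x i j ∈𝔭^ (ℤ.- + b)
      bound x = go x
        where
        go : ∀ {l} (y : Fin l → Fin n → Carrier) → ∃ λ b → ∀ i j → y i j ∈𝔭^ (ℤ.- + b)
        go {zero}  y = 0 , λ ()
        go {suc l} y =
          let b₀ , h₀ = boundedFamily (y zero)
              b₁ , h₁ = go (y ∘ suc)
          in b₀ ℕ.⊔ b₁ , λ where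
            zero    j → ∈𝔭-mono (ℤₚ.neg-mono-≤ (ℤ.+≤+ (ℕₚ.m≤m⊔n b₀ b₁))) (h₀ j)
            (suc i) j → ∈𝔭-mono (ℤₚ.neg-mono-≤ (ℤ.+≤+ (ℕₚ.m≤n⊔m b₀ b₁))) (h₁ i j)

    near-∙ʳ : ∀ q → ∃ λ b → ∀ m {g h} → Near (m ℕ.+ b) g h → Near m (g ∙ q) (h ∙ q)
    near-∙ʳ q = let b , q∈ = bound (matrix q) in b , λ m {g} {h} g~h i j →
      ∈𝔭-resp (sym (trans (+-cong (matrix-∙ h q i j) (-‿cong (matrix-∙ g q i j)))
                   (trans (sum-difference (λ l → matrix h i l * matrix q l j) (λ l → matrix g i l * matrix q l j))
                          (sum-cong-≋ λ l → difference-*ʳ (matrix h i l) (matrix g i l) (matrix q l j)))))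
              (sum-∈𝔭 (λ l → (matrix h i l - matrix g i l) * matrix q l j) λ l → cancel-∈𝔭ʳ (g~h i l) (q∈ l j))

    near-∙ˡ : ∀ q → ∃ λ b → ∀ m {g h} → Near (m ℕ.+ b) g h → Near m (q ∙ g) (q ∙ h)
    near-∙ˡ q = let b , q∈ = bound (matrix q) in b , λ m {g} {h} g~h i j →
      ∈𝔭-resp (sym (trans (+-cong (matrix-∙ q h i j) (-‿cong (matrix-∙ q g i j)))
                   (trans (sum-difference (λ l → matrix q i l * matrix h l j) (λ l → matrix q i l * matrix g l j))
                          (sum-cong-≋ λ l → difference-*ˡ (matrix h l j) (matrix g l j) (matrix q i l)))))
              (sum-∈𝔭 (λ l → matrix q i l * (matrix h l j - matrix g l j)) λ l → cancel-∈𝔭ˡ (q∈ i l) (g~h l j))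

    open-∙ʳ : ∀ {S} q → IsOpen S → IsOpen (λ g → g ∙ q ∈ S)
    open-∙ʳ q o g s = let m , f = o (g ∙ q) s ; b , near = near-∙ʳ q in
      m ℕ.+ b , λ h g~h → f (h ∙ q) (near m g~h)

    open-∙ˡ : ∀ {S} q → IsOpen S → IsOpen (λ g → q ∙ g ∈ S)
    open-∙ˡ q o g s = let m , f = o (q ∙ g) s ; b , near = near-∙ˡ q in
      m ℕ.+ b , λ h g~h → f (q ∙ h) (near m g~h)

    open-∩ : ∀ {S T} → IsOpen S → IsOpen T → IsOpen (S ∩ T)
    open-∩ oS oT g (s , t) =
      let m₁ , f₁ = oS g s ; m₂ , f₂ = oT g t in
      m₁ ℕ.⊔ m₂ , λ h g~h →
        f₁ h (λ i j → ∈𝔭-mono (ℤ.+≤+ (ℕₚ.m≤m⊔n m₁ m₂)) (g~h i j)) ,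
        f₂ h (λ i j → ∈𝔭-mono (ℤ.+≤+ (ℕₚ.m≤n⊔m m₁ m₂)) (g~h i j))

    -- A set stable under right translation by an open neighbourhood of 1 is open.
    open-if-stable : ∀ {N T : Pred Elem 0ℓ} → IsOpen N → ε ∈ N →
      (∀ {g h} → g ≈ᴳ h → g ∈ T → h ∈ T) → (∀ g h → g ∈ T → h ∈ N → g ∙ h ∈ T) → IsOpen T
    open-if-stable o e resp stable g t =
      let m , f = open-∙ˡ (g ⁻¹) o g (open-resp o (symᴳ (inverseˡ g)) e) in
      m , λ h g~h → resp
        (transᴳ (symᴳ (assoc g (g ⁻¹) h)) (transᴳ (∙-congʳ (inverseʳ g)) (identityˡ h)))
        (stable g (g ⁻¹ ∙ h) t (f h g~h))

  record InvertibleMatrix (n : ℕ) : Set where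
    field
      mat      : Matrix n
      inv      : Matrix n
      inverseˡ : inv *ₘ mat ≈ₘ 1ₘ
      inverseʳ : mat *ₘ inv ≈ₘ 1ₘ
  open InvertibleMatrix

  private
    cancel-middle : ∀ {n} (w x y z : Matrix n) → x *ₘ y ≈ₘ 1ₘ → w *ₘ z ≈ₘ 1ₘ → (w *ₘ x) *ₘ (y *ₘ z) ≈ₘ 1ₘ
    cancel-middle w x y z xy wz =
      ≈ₘ-trans (*ₘ-assoc w x (y *ₘ z))
     (≈ₘ-trans (*ₘ-cong (≈ₘ-refl {x = w}) (≈ₘ-trans (≈ₘ-sym (*ₘ-assoc x y z))
        (≈ₘ-trans (*ₘ-cong xy (≈ₘ-refl {x = z})) (*ₘ-identityˡ z)))) wz)

    inv-unique : ∀ {n} (x y y′ : Matrix n) → y *ₘ x ≈ₘ 1ₘ → x *ₘ y′ ≈ₘ 1ₘ → y ≈ₘ y′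
    inv-unique x y y′ yx xy′ =
      ≈ₘ-trans (≈ₘ-sym (*ₘ-identityʳ y))
     (≈ₘ-trans (*ₘ-cong (≈ₘ-refl {x = y}) (≈ₘ-sym xy′))
     (≈ₘ-trans (≈ₘ-sym (*ₘ-assoc y x y′))
     (≈ₘ-trans (*ₘ-cong yx (≈ₘ-refl {x = y′})) (*ₘ-identityˡ y′))))

  GL : ∀ n → LinearGroup n
  GL n = record
    { group = record
      { Carrier = InvertibleMatrix n
      ; _≈_     = λ g h → mat g ≈ₘ mat h
      ; _∙_     = λ g h → record
        { mat      = mat g *ₘ mat h
        ; inv      = inv h *ₘ inv g
        ; inverseˡ = cancel-middle (inv h) (inv g) (mat g) (mat h) (inverseˡ g) (inverseˡ h)
        ; inverseʳ = cancel-middle (mat g) (mat h) (inv h) (inv g) (inverseʳ h) (inverseʳ g) }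
      ; ε       = record
        { mat = 1ₘ ; inv = 1ₘ ; inverseˡ = *ₘ-identityˡ 1ₘ ; inverseʳ = *ₘ-identityˡ 1ₘ }
      ; _⁻¹     = λ g → record
        { mat = inv g ; inv = mat g ; inverseˡ = inverseʳ g ; inverseʳ = inverseˡ g }
      ; isGroup = record
        { isMonoid = record
          { isSemigroup = record
            { isMagma = record
              { isEquivalence = record { refl = ≈ₘ-refl ; sym = ≈ₘ-sym ; trans = ≈ₘ-trans }
              ; ∙-cong = *ₘ-cong }
            ; assoc = λ g h k → *ₘ-assoc (mat g) (mat h) (mat k) }
          ; identity = (λ g → *ₘ-identityˡ (mat g)) , (λ g → *ₘ-identityʳ (mat g)) }
        ; inverse = inverseˡ , inverseʳ
        ; ⁻¹-cong = λ {g} {h} g≈h → inv-unique (mat g) (inv g) (inv h) (inverseˡ g)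
            (≈ₘ-trans (*ₘ-cong g≈h (≈ₘ-refl {x = inv h})) (inverseʳ h)) } }
    ; matrix           = mat
    ; matrix-cong      = λ p → p
    ; matrix-injective = λ p → p
    ; matrix-ε         = ≈ₘ-refl
    ; matrix-∙         = λ _ _ → ≈ₘ-refl }

  -- The last row is (0, …, 0, 1).
  IsMirabolic : ∀ {m} → Pred (Matrix (suc m)) 0ℓ
  IsMirabolic {m} x = ∀ j → x (fromℕ m) j ≈ 1ₘ (fromℕ m) j

  private
    mirabolic-∙ : ∀ {m} (x y : Matrix (suc m)) → IsMirabolic x → IsMirabolic y → IsMirabolic (x *ₘ y)
    mirabolic-∙ {m} x y px py j =
      trans (sum-cong-≋ (λ l → *-congʳ {y l j} (px l))) (trans (1ₘ-sumˡ (fromℕ m) (λ l → y l j)) (py j))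

    mirabolic-⁻¹ : ∀ {m} (x y : Matrix (suc m)) → x *ₘ y ≈ₘ 1ₘ → IsMirabolic x → IsMirabolic y
    mirabolic-⁻¹ {m} x y xy px j =
      trans (sym (1ₘ-sumˡ (fromℕ m) (λ l → y l j)))
     (trans (sum-cong-≋ (λ l → *-congʳ {y l j} (sym (px l)))) (xy (fromℕ m) j))

  Mirabolic : ∀ m → LinearGroup (suc m)
  Mirabolic m = record
    { group = record
      { Carrier = Σ GLₙ.Elem λ g → IsMirabolic (mat g)
      ; _≈_     = λ g h → proj₁ g GLₙ.≈ᴳ proj₁ h
      ; _∙_     = λ (g , pg) (h , ph) → g GLₙ.∙ h , mirabolic-∙ (mat g) (mat h) pg ph
      ; ε       = GLₙ.ε , λ _ → refl
      ; _⁻¹     = λ (g , pg) → g GLₙ.⁻¹ , mirabolic-⁻¹ (mat g) (inv g) (inverseʳ g) pg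
      ; isGroup = record
        { isMonoid = record
          { isSemigroup = record
            { isMagma = record
              { isEquivalence = record { refl = ≈ₘ-refl ; sym = ≈ₘ-sym ; trans = ≈ₘ-trans }
              ; ∙-cong = *ₘ-cong }
            ; assoc = λ g h k → GLₙ.assoc (proj₁ g) (proj₁ h) (proj₁ k) }
          ; identity = (λ g → GLₙ.identityˡ (proj₁ g)) , (λ g → GLₙ.identityʳ (proj₁ g)) }
        ; inverse = (λ g → GLₙ.inverseˡ (proj₁ g)) , (λ g → GLₙ.inverseʳ (proj₁ g))
        ; ⁻¹-cong = λ {g} {h} → GLₙ.⁻¹-cong {proj₁ g} {proj₁ h} } }
    ; matrix           = λ g → mat (proj₁ g)
    ; matrix-cong      = λ p → p
    ; matrix-injective = λ p → p
    ; matrix-ε         = ≈ₘ-refl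
    ; matrix-∙         = λ _ _ → ≈ₘ-refl }
    where module GLₙ = LinearGroup (GL (suc m))

  -- Unipotent upper triangular.
  IsUnipotentUpper : ∀ {n} → Pred (Matrix n) 0ℓ
  IsUnipotentUpper x = (∀ i → x i i ≈ 1#) × (∀ i j → j Fin.< i → x i j ≈ 0#)

  superdiagonalSum : ∀ {m} → Matrix (suc m) → Carrier
  superdiagonalSum {m} x = sum {m} λ i → x (inject₁ i) (suc i)

module Representations {p : ℕ} (F : PAdicField p) where
  open LinearGroups F

  record SmoothRep {n : ℕ} (R : CRing) (L : LinearGroup n) c : Set (lsuc c ⊔ 1ℓ) where
    open LinearGroup L
    field
      modul : Mod R c
    open LeftModule modul public
    infixr 7 _•_
    field
      _•_    : Elem → Carrierᴹ → Carrierᴹ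
      •-cong : ∀ {g h x y} → g ≈ᴳ h → x ≈ᴹ y → g • x ≈ᴹ h • y
      •-ε    : ∀ x → ε • x ≈ᴹ x
      •-∙    : ∀ g h x → (g ∙ h) • x ≈ᴹ g • (h • x)
      •-+    : ∀ g x y → g • (x +ᴹ y) ≈ᴹ g • x +ᴹ g • y
      •-*ₗ   : ∀ g r x → g • (r *ₗ x) ≈ᴹ r *ₗ (g • x)
      smooth : ∀ x → IsOpen (λ g → g • x ≈ᴹ x)

  record RepHom {n : ℕ} {R : CRing} {L : LinearGroup n}
                (V : SmoothRep R L c) (V′ : SmoothRep R L d) : Set (c ⊔ d) where
    private
      module V = SmoothRep V
      module V′ = SmoothRep V′
    field
      linear      : LinearMap V.modul V′.modul
    open LinearMap linear public
    field
      equivariant : ∀ g x → ⟦ g V.• x ⟧ V′.≈ᴹ g V′.• ⟦ x ⟧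

  restrictRep : ∀ {n} {W : CRing} (A : Algebra W) {L : LinearGroup n} →
                SmoothRep (Algebra.ring A) L c → SmoothRep W L c
  restrictRep A V = record
    { modul  = restrictScalars A modul
    ; _•_    = _•_
    ; •-cong = •-cong
    ; •-ε    = •-ε
    ; •-∙    = •-∙
    ; •-+    = •-+
    ; •-*ₗ   = λ g w → •-*ₗ g _
    ; smooth = smooth }
    where open SmoothRep V

  restrictToMirabolic : ∀ {m} {R : CRing} → SmoothRep R (GL (suc m)) c → SmoothRep R (Mirabolic m) c
  restrictToMirabolic V = record
    { modul  = modul
    ; _•_    = λ g → proj₁ g •_
    ; •-cong = •-cong
    ; •-ε    = •-ε
    ; •-∙    = λ g h → •-∙ (proj₁ g) (proj₁ h)
    ; •-+    = λ g → •-+ (proj₁ g)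
    ; •-*ₗ   = λ g → •-*ₗ (proj₁ g)
    ; smooth = λ x g s → proj₁ (smooth x (proj₁ g) s) , λ h → proj₂ (smooth x (proj₁ g) s) (proj₁ h) }
    where open SmoothRep V

  -- A natural endomorphism of the identity functor of Rep_R(L), the category of
  -- smooth R[L]-modules with underlying type in Set.
  record NatEnd {n : ℕ} (R : CRing) (L : LinearGroup n) : Set₁ where
    field
      at      : (V : SmoothRep R L 0ℓ) → RepHom V V
      natural : ∀ {V V′ : SmoothRep R L 0ℓ} (h : RepHom V V′) x →
                SmoothRep._≈ᴹ_ V′ (RepHom.⟦_⟧ h (RepHom.⟦_⟧ (at V) x)) (RepHom.⟦_⟧ (at V′) (RepHom.⟦_⟧ h x))

    _⟪_⟫ : (V : SmoothRep R L 0ℓ) → SmoothRep.Carrierᴹ V → SmoothRep.Carrierᴹ V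
    V ⟪ x ⟫ = RepHom.⟦_⟧ (at V) x

  module _ {n : ℕ} {R : CRing} {L : LinearGroup n} (V : SmoothRep R L 0ℓ) where
    open SmoothRep V
    open ModuleLemmas modul
    open RepHom

    private
      •-0 : ∀ g → g • 0ᴹ ≈ᴹ 0ᴹ
      •-0 g = ≈ᴹ-trans (•-cong (LinearGroup.reflᴳ L) (≈ᴹ-sym (*ₗ-zeroˡ 0ᴹ)))
             (≈ᴹ-trans (•-*ₗ g (CommutativeRing.0# R) 0ᴹ) (*ₗ-zeroˡ _))

      •-neg : ∀ g x → g • (-ᴹ x) ≈ᴹ -ᴹ (g • x)
      •-neg g x = -ᴹ-unique (g • x) (g • (-ᴹ x))
        (≈ᴹ-trans (≈ᴹ-sym (•-+ g x (-ᴹ x)))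
        (≈ᴹ-trans (•-cong (LinearGroup.reflᴳ L) (-ᴹ‿inverseʳ x)) (•-0 g)))

    idHom : RepHom V V
    idHom = record
      { linear      = mkLinearMap modul modul (λ x → x) (λ p → p) (λ _ _ → ≈ᴹ-refl) (λ _ _ → ≈ᴹ-refl)
      ; equivariant = λ _ _ → ≈ᴹ-refl }

    zeroHom : RepHom V V
    zeroHom = record
      { linear      = mkLinearMap modul modul (λ _ → 0ᴹ) (λ _ → ≈ᴹ-refl)
                        (λ _ _ → ≈ᴹ-sym (+ᴹ-identityˡ 0ᴹ)) (λ r _ → ≈ᴹ-sym (*ₗ-zeroʳ r))
      ; equivariant = λ g _ → ≈ᴹ-sym (•-0 g) }

    _+Hom_ : RepHom V V → RepHom V V → RepHom V V
    f +Hom g = record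
      { linear      = mkLinearMap modul modul (λ x → ⟦ f ⟧ x +ᴹ ⟦ g ⟧ x)
                        (λ p → +ᴹ-cong (⟦⟧-cong f p) (⟦⟧-cong g p))
                        (λ x y → ≈ᴹ-trans (+ᴹ-cong (+ᴹ-homo f x y) (+ᴹ-homo g x y)) (interchange _ _ _ _))
                        (λ r x → ≈ᴹ-trans (+ᴹ-cong (*ₗ-homo f r x) (*ₗ-homo g r x)) (≈ᴹ-sym (*ₗ-distribˡ r _ _)))
      ; equivariant = λ h x → ≈ᴹ-trans (+ᴹ-cong (equivariant f h x) (equivariant g h x)) (≈ᴹ-sym (•-+ h _ _)) }

    -Hom_ : RepHom V V → RepHom V V
    -Hom f = record
      { linear      = mkLinearMap modul modul (λ x → -ᴹ (⟦ f ⟧ x))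
                        (λ p → -ᴹ‿cong (⟦⟧-cong f p))
                        (λ x y → ≈ᴹ-trans (-ᴹ‿cong (+ᴹ-homo f x y)) (-ᴹ-+ _ _))
                        (λ r x → ≈ᴹ-trans (-ᴹ‿cong (*ₗ-homo f r x)) (≈ᴹ-sym (*ₗ--ᴹ r _)))
      ; equivariant = λ h x → ≈ᴹ-trans (-ᴹ‿cong (equivariant f h x)) (≈ᴹ-sym (•-neg h _)) }

    _∘Hom_ : RepHom V V → RepHom V V → RepHom V V
    f ∘Hom g = record
      { linear      = mkLinearMap modul modul (λ x → ⟦ f ⟧ (⟦ g ⟧ x))
                        (λ p → ⟦⟧-cong f (⟦⟧-cong g p))
                        (λ x y → ≈ᴹ-trans (⟦⟧-cong f (+ᴹ-homo g x y)) (+ᴹ-homo f _ _))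
                        (λ r x → ≈ᴹ-trans (⟦⟧-cong f (*ₗ-homo g r x)) (*ₗ-homo f r _))
      ; equivariant = λ h x → ≈ᴹ-trans (⟦⟧-cong f (equivariant g h x)) (equivariant f h _) }

  -- Multiplication is composition; it is commutative by naturality.
  centre : ∀ {n} (R : CRing) (L : LinearGroup n) → CommutativeRing 1ℓ 1ℓ
  centre R L = record
    { Carrier = NatEnd R L
    ; _≈_     = λ z w → ∀ V x → SmoothRep._≈ᴹ_ V (⟦ at z V ⟧ x) (⟦ at w V ⟧ x)
    ; _+_     = λ z w → record
      { at      = λ V → _+Hom_ V (at z V) (at w V)
      ; natural = λ {V} {V′} h x → let open SmoothRep V′ in
          ≈ᴹ-trans (+ᴹ-homo h _ _) (+ᴹ-cong (natural z h x) (natural w h x)) }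
    ; _*_     = λ z w → record
      { at      = λ V → _∘Hom_ V (at z V) (at w V)
      ; natural = λ {V} {V′} h x → let open SmoothRep V′ in
          ≈ᴹ-trans (natural z h _) (⟦⟧-cong (at z V′) (natural w h x)) }
    ; -_      = λ z → record
      { at      = λ V → -Hom_ V (at z V)
      ; natural = λ {V} {V′} h x → let open SmoothRep V′ in
          ≈ᴹ-trans (-ᴹ-homo h _) (-ᴹ‿cong (natural z h x)) }
    ; 0#      = record { at = zeroHom ; natural = λ {V} {V′} h _ → 0ᴹ-homo h }
    ; 1#      = record { at = idHom ; natural = λ {V} {V′} h _ → SmoothRep.≈ᴹ-refl V′ }
    ; isCommutativeRing = record
      { isRing = record
        { +-isAbelianGroup = record
          { isGroup = record
            { isMonoid = record
              { isSemigroup = record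
                { isMagma = record
                  { isEquivalence = record
                    { refl  = λ V _ → SmoothRep.≈ᴹ-refl V
                    ; sym   = λ p V x → SmoothRep.≈ᴹ-sym V (p V x)
                    ; trans = λ p q V x → SmoothRep.≈ᴹ-trans V (p V x) (q V x) }
                  ; ∙-cong = λ p q V x → SmoothRep.+ᴹ-cong V (p V x) (q V x) }
                ; assoc = λ _ _ _ V _ → SmoothRep.+ᴹ-assoc V _ _ _ }
              ; identity = (λ _ V _ → SmoothRep.+ᴹ-identityˡ V _) , (λ _ V _ → SmoothRep.+ᴹ-identityʳ V _) }
            ; inverse = (λ _ V _ → SmoothRep.-ᴹ‿inverseˡ V _) , (λ _ V _ → SmoothRep.-ᴹ‿inverseʳ V _)
            ; ⁻¹-cong = λ p V x → SmoothRep.-ᴹ‿cong V (p V x) }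
          ; comm = λ _ _ V _ → SmoothRep.+ᴹ-comm V _ _ }
        ; *-cong     = λ {z} p q V x → SmoothRep.≈ᴹ-trans V (⟦⟧-cong (at z V) (q V x)) (p V _)
        ; *-assoc    = λ _ _ _ V _ → SmoothRep.≈ᴹ-refl V
        ; *-identity = (λ _ V _ → SmoothRep.≈ᴹ-refl V) , (λ _ V _ → SmoothRep.≈ᴹ-refl V)
        ; distrib    = (λ z _ _ V _ → +ᴹ-homo (at z V) _ _) , (λ _ _ _ V _ → SmoothRep.≈ᴹ-refl V) }
      ; *-comm = λ z w V x → natural w (at z V) x } }
    where open NatEnd
          open RepHom


-- Throughout, n = suc m, so n ≥ 1.
module Whittaker {p : ℕ} (F : PAdicField p) (W : CRing) (χ : AdditiveCharacter F W) (m : ℕ) where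
  private module F = PAdicField F
  open LinearGroups F public
  open Representations F public
  open AdditiveCharacter χ using (ψ)

  Gₙ Pₙ : LinearGroup (suc m)
  Gₙ = GL (suc m)
  Pₙ = Mirabolic m

  ψᵁ : Matrix (suc m) → ∣ W ∣
  ψᵁ u = ψ (superdiagonalSum u)

  module _ (L : LinearGroup (suc m)) where
    open LinearGroup L

    IsU : Pred Elem 0ℓ
    IsU u = IsUnipotentUpper (matrix u)

    -- Elements of Ind_U^L ψ_M; being fixed by an open subgroup is expressed as
    -- openness of the stabiliser under right translation.
    record IndFun (A : Algebra W) (M : Mod (Algebra.ring A) c) : Set c where
      private module A = Algebra A
      open LeftModule M
      field
        fun         : Elem → Carrierᴹ
        fun-cong    : ∀ {g h} → g ≈ᴳ h → fun g ≈ᴹ fun h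
        equivariant : ∀ u g → u ∈ IsU → fun (u ∙ g) ≈ᴹ A.η (ψᵁ (matrix u)) *ₗ fun g
        smooth      : IsOpen (λ k → ∀ g → fun (g ∙ k) ≈ᴹ fun g)

    module _ (A : Algebra W) (M : Mod (Algebra.ring A) c) where
      private module A = Algebra A
      open LeftModule M
      open ModuleLemmas M
      open IndFun

      private
        Stab : (Elem → Carrierᴹ) → Pred Elem 0ℓ
        Stab f k = ∀ g → f (g ∙ k) ≈ᴹ f g

        Stab-open : ∀ {f N} → (∀ {g h} → g ≈ᴳ h → f g ≈ᴹ f h) → IsOpen N → ε ∈ N → N ⊆ Stab f → IsOpen (Stab f)
        Stab-open f-cong o e N⊆ = open-if-stable o e
          (λ k≈k′ s g → ≈ᴹ-trans (f-cong (∙-congˡ (symᴳ k≈k′))) (s g))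
          (λ k n s n∈ g → ≈ᴹ-trans (f-cong (symᴳ (assoc g k n))) (≈ᴹ-trans (N⊆ n∈ (g ∙ k)) (s g)))

        ε∈Stab : (f : IndFun A M) → ε ∈ Stab (fun f)
        ε∈Stab f g = fun-cong f (identityʳ g)

        *ₗ-swap : ∀ r s x → r *ₗ (s *ₗ x) ≈ᴹ s *ₗ (r *ₗ x)
        *ₗ-swap r s x = ≈ᴹ-trans (≈ᴹ-sym (*ₗ-assoc r s x)) (≈ᴹ-trans (*ₗ-congʳ (A.*-comm r s)) (*ₗ-assoc s r x))

      addFun : IndFun A M → IndFun A M → IndFun A M
      addFun f h = record
        { fun         = λ g → fun f g +ᴹ fun h g
        ; fun-cong    = cong′
        ; equivariant = λ u g u∈ → ≈ᴹ-trans (+ᴹ-cong (equivariant f u g u∈) (equivariant h u g u∈))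
                                            (≈ᴹ-sym (*ₗ-distribˡ _ _ _))
        ; smooth      = Stab-open cong′ (open-∩ (smooth f) (smooth h)) (ε∈Stab f , ε∈Stab h)
                          (λ (s , t) g → +ᴹ-cong (s g) (t g)) }
        where
        cong′ : ∀ {g g′} → g ≈ᴳ g′ → fun f g +ᴹ fun h g ≈ᴹ fun f g′ +ᴹ fun h g′
        cong′ e = +ᴹ-cong (fun-cong f e) (fun-cong h e)

      scaleFun : A.Carrier → IndFun A M → IndFun A M
      scaleFun r f = record
        { fun         = λ g → r *ₗ fun f g
        ; fun-cong    = cong′
        ; equivariant = λ u g u∈ → ≈ᴹ-trans (*ₗ-congˡ (equivariant f u g u∈)) (*ₗ-swap r _ _)
        ; smooth      = Stab-open cong′ (smooth f) (ε∈Stab f) (λ s g → *ₗ-congˡ (s g)) }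
        where
        cong′ : ∀ {g g′} → g ≈ᴳ g′ → r *ₗ fun f g ≈ᴹ r *ₗ fun f g′
        cong′ e = *ₗ-congˡ (fun-cong f e)

      zeroFun : IndFun A M
      zeroFun = record
        { fun         = λ _ → 0ᴹ
        ; fun-cong    = λ _ → ≈ᴹ-refl
        ; equivariant = λ _ _ _ → ≈ᴹ-sym (*ₗ-zeroʳ _)
        ; smooth      = λ _ _ → 0 , λ _ _ _ → ≈ᴹ-refl }

      negFun : IndFun A M → IndFun A M
      negFun f = record
        { fun         = λ g → -ᴹ fun f g
        ; fun-cong    = cong′
        ; equivariant = λ u g u∈ → ≈ᴹ-trans (-ᴹ‿cong (equivariant f u g u∈)) (≈ᴹ-sym (*ₗ--ᴹ _ _))
        ; smooth      = Stab-open cong′ (smooth f) (ε∈Stab f) (λ s g → -ᴹ‿cong (s g)) }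
        where
        cong′ : ∀ {g g′} → g ≈ᴳ g′ → -ᴹ fun f g ≈ᴹ -ᴹ fun f g′
        cong′ e = -ᴹ‿cong (fun-cong f e)

      translateFun : Elem → IndFun A M → IndFun A M
      translateFun q f = record
        { fun         = λ g → fun f (g ∙ q)
        ; fun-cong    = cong′
        ; equivariant = λ u g u∈ → ≈ᴹ-trans (fun-cong f (assoc u g q)) (equivariant f u (g ∙ q) u∈)
        ; smooth      = Stab-open cong′ (open-∙ʳ q (open-∙ˡ (q ⁻¹) (smooth′ f)))
                          (λ g → ≈ᴹ-trans (fun-cong f (∙-congˡ (transᴳ (∙-congˡ (identityˡ q)) (inverseˡ q)))) (ε∈Stab f g))
                          (λ {k} s g → ≈ᴹ-trans (fun-cong f (conjugate g k)) (s (g ∙ q))) }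
        where
        smooth′ : (f : IndFun A M) → IsOpen (Stab (fun f))
        smooth′ = smooth
        cong′ : ∀ {g g′} → g ≈ᴳ g′ → fun f (g ∙ q) ≈ᴹ fun f (g′ ∙ q)
        cong′ e = fun-cong f (∙-congʳ e)
        conjugate : ∀ g k → (g ∙ k) ∙ q ≈ᴳ (g ∙ q) ∙ (q ⁻¹ ∙ (k ∙ q))
        conjugate g k = transᴳ (assoc g k q) (symᴳ (transᴳ (assoc g q _)
          (∙-congˡ (transᴳ (symᴳ (assoc q (q ⁻¹) (k ∙ q))) (transᴳ (∙-congʳ (inverseʳ q)) (identityˡ (k ∙ q)))))))

      Ind : SmoothRep A.ring L c
      Ind = record
        { modul = record
          { Carrierᴹ = IndFun A M
          ; _≈ᴹ_ = λ f h → ∀ g → fun f g ≈ᴹ fun h g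
          ; _+ᴹ_ = addFun
          ; _*ₗ_ = scaleFun
          ; 0ᴹ   = zeroFun
          ; -ᴹ_  = negFun
          ; isLeftModule = record
            { isLeftSemimodule = record
              { +ᴹ-isCommutativeMonoid = record
                { isMonoid = record
                  { isSemigroup = record
                    { isMagma = record
                      { isEquivalence = record
                        { refl  = λ _ → ≈ᴹ-refl
                        ; sym   = λ e g → ≈ᴹ-sym (e g)
                        ; trans = λ d e g → ≈ᴹ-trans (d g) (e g) }
                      ; ∙-cong = λ d e g → +ᴹ-cong (d g) (e g) }
                    ; assoc = λ _ _ _ _ → +ᴹ-assoc _ _ _ }
                  ; identity = (λ _ _ → +ᴹ-identityˡ _) , (λ _ _ → +ᴹ-identityʳ _) }
                ; comm = λ _ _ _ → +ᴹ-comm _ _ }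
              ; isPreleftSemimodule = record
                { *ₗ-cong      = λ d e g → *ₗ-cong d (e g)
                ; *ₗ-zeroˡ     = λ _ _ → *ₗ-zeroˡ _
                ; *ₗ-distribʳ  = λ _ _ _ _ → *ₗ-distribʳ _ _ _
                ; *ₗ-identityˡ = λ _ _ → *ₗ-identityˡ _
                ; *ₗ-assoc     = λ _ _ _ _ → *ₗ-assoc _ _ _
                ; *ₗ-zeroʳ     = λ _ _ → *ₗ-zeroʳ _
                ; *ₗ-distribˡ  = λ _ _ _ _ → *ₗ-distribˡ _ _ _ } }
            ; -ᴹ‿cong    = λ e g → -ᴹ‿cong (e g)
            ; -ᴹ‿inverse = (λ _ _ → -ᴹ‿inverseˡ _) , (λ _ _ → -ᴹ‿inverseʳ _) } }
        ; _•_    = translateFun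
        ; •-cong = λ {q} {q′} {f} q≈ f≈ g → ≈ᴹ-trans (fun-cong f (∙-congˡ q≈)) (f≈ _)
        ; •-ε    = λ f g → fun-cong f (identityʳ g)
        ; •-∙    = λ q q′ f g → fun-cong f (symᴳ (assoc g q q′))
        ; •-+    = λ _ _ _ _ → ≈ᴹ-refl
        ; •-*ₗ   = λ _ _ _ _ → ≈ᴹ-refl
        ; smooth = smooth }

      -- The support of f has compact image in U\L: it is contained in a set
      -- with compact image.
      CompactSupport : IndFun A M → Set₁
      CompactSupport f = ∃ λ S → IsCompactModulo IsU S × (∀ g → g ∉ S → fun f g ≈ᴹ 0ᴹ)

      c-IndFun : Set (1ℓ ⊔ c)
      c-IndFun = Σ (IndFun A M) CompactSupport

      private
        compact-∪ : ∀ {S T} → IsCompactModulo IsU S → IsCompactModulo IsU T → IsCompactModulo IsU (S ∪ T)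
        compact-∪ cS cT O o st cov =
          let is , isS = cS O o st (λ g s → cov g (inj₁ s))
              js , jsT = cT O o st (λ g t → cov g (inj₂ t))
          in is ++ js , λ where
            g (inj₁ s) → Anyₚ.++⁺ˡ (isS g s)
            g (inj₂ t) → Anyₚ.++⁺ʳ is (jsT g t)

        support-+ : ∀ f h → CompactSupport f → CompactSupport h → CompactSupport (addFun f h)
        support-+ f h (S , cS , f0) (T , cT , h0) = S ∪ T , compact-∪ cS cT , λ g g∉ →
          ≈ᴹ-trans (+ᴹ-cong (f0 g (g∉ ∘ inj₁)) (h0 g (g∉ ∘ inj₂))) (+ᴹ-identityˡ 0ᴹ)

        support-translate : ∀ q f → CompactSupport f → CompactSupport (translateFun q f)
        support-translate q f (S , cS , f0) =
          (λ g → ∃ λ s → s ∈ S × g ≈ᴳ s ∙ q ⁻¹) ,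
          (λ O o st cov →
            let is , isS = cS (λ i g → g ∙ q ⁻¹ ∈ O i) (λ i → open-∙ʳ (q ⁻¹) (o i))
                              (λ i u g u∈ x → open-resp (o i) (symᴳ (assoc u g (q ⁻¹))) (st i u _ u∈ x))
                              (λ s s∈ → cov (s ∙ q ⁻¹) (s , s∈ , reflᴳ))
            in is , λ g (s , s∈ , g≈) → Any.map (λ {i} → open-resp (o i) (symᴳ g≈)) (isS s s∈)) ,
          (λ g g∉ → f0 (g ∙ q) λ s∈ → g∉ (g ∙ q , s∈ ,
            symᴳ (transᴳ (assoc g q (q ⁻¹)) (transᴳ (∙-congˡ (inverseʳ q)) (identityʳ g)))))

      private
        module I = SmoothRep Ind

        c-raw : RawLeftModule A.Carrier (1ℓ ⊔ c) 0ℓ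
        c-raw = record
          { Carrierᴹ = c-IndFun
          ; _≈ᴹ_ = λ f h → proj₁ f I.≈ᴹ proj₁ h
          ; _+ᴹ_ = λ (f , s) (h , t) → addFun f h , support-+ f h s t
          ; _*ₗ_ = λ r (f , S , cS , f0) → scaleFun r f , S , cS , λ g g∉ → ≈ᴹ-trans (*ₗ-congˡ (f0 g g∉)) (*ₗ-zeroʳ r)
          ; 0ᴹ   = zeroFun , ∅ , (λ _ _ _ _ → [] , λ _ ()) , λ _ _ → ≈ᴹ-refl
          ; -ᴹ_  = λ (f , S , cS , f0) → negFun f , S , cS , λ g g∉ →
              ≈ᴹ-trans (-ᴹ‿cong (f0 g g∉)) -ᴹ0≈0 }

      c-Ind : SmoothRep A.ring L (1ℓ ⊔ c)
      c-Ind = record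
        { modul = record
          { RawLeftModule c-raw
          ; isLeftModule = LeftModuleMono.isLeftModule {M = c-raw} {N = I.rawLeftModule} {⟦_⟧ = proj₁}
              (record
                { isLeftModuleHomomorphism = record
                  { +ᴹ-isGroupHomomorphism = record
                    { isMonoidHomomorphism = record
                      { isMagmaHomomorphism = record
                        { isRelHomomorphism = record { cong = λ e → e } ; homo = λ _ _ _ → ≈ᴹ-refl }
                      ; ε-homo = λ _ → ≈ᴹ-refl }
                    ; ⁻¹-homo = λ _ _ → ≈ᴹ-refl }
                  ; *ₗ-homo = λ _ _ _ → ≈ᴹ-refl }
                ; injective = λ e → e })
              A.isRing I.isLeftModule }
        ; _•_    = λ q (f , s) → translateFun q f , support-translate q f s
        ; •-cong = λ {q} {q′} {f} {f′} → I.•-cong {q} {q′} {proj₁ f} {proj₁ f′}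
        ; •-ε    = λ (f , _) → I.•-ε f
        ; •-∙    = λ q q′ (f , _) → I.•-∙ q q′ f
        ; •-+    = λ _ _ _ _ → ≈ᴹ-refl
        ; •-*ₗ   = λ _ _ _ _ → ≈ᴹ-refl
        ; smooth = λ (f , _) → smooth f }

    -- Functoriality in the coefficients, along W-linear maps (ψ takes values in W).
    module _ (A : Algebra W) (M : Mod (Algebra.ring A) c) (B : Algebra W) (N : Mod (Algebra.ring B) d)
             (t : LinearMap (restrictScalars A M) (restrictScalars B N)) where
      private
        module M = LeftModule M
        module N = LeftModule N
        module t = LinearMap t
      open IndFun

      Ind-map : IndFun A M → IndFun B N
      Ind-map f = record
        { fun         = λ g → t.⟦ fun f g ⟧
        ; fun-cong    = λ e → t.⟦⟧-cong (fun-cong f e)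
        ; equivariant = λ u g u∈ → N.≈ᴹ-trans (t.⟦⟧-cong (equivariant f u g u∈)) (t.*ₗ-homo _ _)
        ; smooth      = open-if-stable (smooth f) (λ g → fun-cong f (identityʳ g))
            (λ k≈k′ s g → N.≈ᴹ-trans (t.⟦⟧-cong (fun-cong f (∙-congˡ (symᴳ k≈k′)))) (s g))
            (λ k n s n∈ g → N.≈ᴹ-trans (t.⟦⟧-cong (M.≈ᴹ-trans (fun-cong f (symᴳ (assoc g k n))) (n∈ (g ∙ k)))) (s g)) }

      c-Ind-map : c-IndFun A M → c-IndFun B N
      c-Ind-map (f , S , cS , f0) =
        Ind-map f , S , cS , λ g g∉ → N.≈ᴹ-trans (t.⟦⟧-cong (f0 g g∉)) t.0ᴹ-homo

  module _ (A : Algebra W) (V : SmoothRep (Algebra.ring A) Gₙ 0ℓ) where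
    private module A = Algebra A
    open LinearGroup Gₙ
    open SmoothRep V
    open ModuleLemmas modul

    -- The A-submodule generated by the elements uv − ψ(u)v.
    data ψ-Span : Pred Carrierᴹ 0ℓ where
      generator : ∀ u x → u ∈ IsU Gₙ → u • x +ᴹ -ᴹ (A.η (ψᵁ (matrix u)) *ₗ x) ∈ ψ-Span
      zero∈     : 0ᴹ ∈ ψ-Span
      +∈        : ∀ {x y} → x ∈ ψ-Span → y ∈ ψ-Span → x +ᴹ y ∈ ψ-Span
      *∈        : ∀ r {x} → x ∈ ψ-Span → r *ₗ x ∈ ψ-Span
      resp∈     : ∀ {x y} → x ≈ᴹ y → x ∈ ψ-Span → y ∈ ψ-Span

    infix 4 _≈ψ_
    _≈ψ_ : Carrierᴹ → Carrierᴹ → Set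
    x ≈ψ y = x +ᴹ -ᴹ y ∈ ψ-Span

    neg∈ : ∀ {x} → x ∈ ψ-Span → -ᴹ x ∈ ψ-Span
    neg∈ x∈ = resp∈ (-1*ₗ _) (*∈ _ x∈)

    ≈⇒≈ψ : ∀ {x y} → x ≈ᴹ y → x ≈ψ y
    ≈⇒≈ψ {x} {y} e = resp∈ (≈ᴹ-sym (≈ᴹ-trans (+ᴹ-cong e ≈ᴹ-refl) (-ᴹ‿inverseʳ y))) zero∈

    ≈ψ-sym : ∀ {x y} → x ≈ψ y → y ≈ψ x
    ≈ψ-sym {x} {y} e = resp∈
      (≈ᴹ-trans (-ᴹ-+ x (-ᴹ y)) (≈ᴹ-trans (+ᴹ-comm _ _) (+ᴹ-cong (-ᴹ-involutive y) ≈ᴹ-refl))) (neg∈ e)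

    ≈ψ-trans : ∀ {x y z} → x ≈ψ y → y ≈ψ z → x ≈ψ z
    ≈ψ-trans {x} {y} {z} d e = resp∈
      (≈ᴹ-trans (+ᴹ-assoc x (-ᴹ y) (y +ᴹ -ᴹ z)) (+ᴹ-cong ≈ᴹ-refl
        (≈ᴹ-trans (≈ᴹ-sym (+ᴹ-assoc (-ᴹ y) y (-ᴹ z)))
        (≈ᴹ-trans (+ᴹ-cong (-ᴹ‿inverseˡ y) ≈ᴹ-refl) (+ᴹ-identityˡ _))))) (+∈ d e)

    +-≈ψ : ∀ {x x′ y y′} → x ≈ψ x′ → y ≈ψ y′ → x +ᴹ y ≈ψ x′ +ᴹ y′
    +-≈ψ d e = resp∈
      (≈ᴹ-trans (interchange _ _ _ _) (+ᴹ-cong ≈ᴹ-refl (≈ᴹ-sym (-ᴹ-+ _ _)))) (+∈ d e)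

    *-≈ψ : ∀ r {x y} → x ≈ψ y → r *ₗ x ≈ψ r *ₗ y
    *-≈ψ r d = resp∈ (≈ᴹ-trans (*ₗ-distribˡ r _ _) (+ᴹ-cong ≈ᴹ-refl (*ₗ--ᴹ r _))) (*∈ r d)

    neg-≈ψ : ∀ {x y} → x ≈ψ y → -ᴹ x ≈ψ -ᴹ y
    neg-≈ψ d = resp∈ (-ᴹ-+ _ _) (neg∈ d)

    -- V⁽ⁿ⁾: the quotient has the same carrier as V and the coarser equality ≈ψ.
    Coinvariants : Mod A.ring 0ℓ
    Coinvariants = record
      { Carrierᴹ = Carrierᴹ
      ; _≈ᴹ_ = _≈ψ_
      ; _+ᴹ_ = _+ᴹ_
      ; _*ₗ_ = _*ₗ_
      ; 0ᴹ   = 0ᴹ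
      ; -ᴹ_  = -ᴹ_
      ; isLeftModule = record
        { isLeftSemimodule = record
          { +ᴹ-isCommutativeMonoid = record
            { isMonoid = record
              { isSemigroup = record
                { isMagma = record
                  { isEquivalence = record { refl = ≈⇒≈ψ ≈ᴹ-refl ; sym = ≈ψ-sym ; trans = ≈ψ-trans }
                  ; ∙-cong = +-≈ψ }
                ; assoc = λ x y z → ≈⇒≈ψ (+ᴹ-assoc x y z) }
              ; identity = (λ x → ≈⇒≈ψ (+ᴹ-identityˡ x)) , (λ x → ≈⇒≈ψ (+ᴹ-identityʳ x)) }
            ; comm = λ x y → ≈⇒≈ψ (+ᴹ-comm x y) }
          ; isPreleftSemimodule = record
            { *ₗ-cong      = λ {r} {s} {x} {y} d e → ≈ψ-trans (*-≈ψ r e) (≈⇒≈ψ (*ₗ-congʳ d))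
            ; *ₗ-zeroˡ     = λ x → ≈⇒≈ψ (*ₗ-zeroˡ x)
            ; *ₗ-distribʳ  = λ x r s → ≈⇒≈ψ (*ₗ-distribʳ x r s)
            ; *ₗ-identityˡ = λ x → ≈⇒≈ψ (*ₗ-identityˡ x)
            ; *ₗ-assoc     = λ r s x → ≈⇒≈ψ (*ₗ-assoc r s x)
            ; *ₗ-zeroʳ     = λ r → ≈⇒≈ψ (*ₗ-zeroʳ r)
            ; *ₗ-distribˡ  = λ r x y → ≈⇒≈ψ (*ₗ-distribˡ r x y) } }
        ; -ᴹ‿cong    = neg-≈ψ
        ; -ᴹ‿inverse = (λ x → ≈⇒≈ψ (-ᴹ‿inverseˡ x)) , (λ x → ≈⇒≈ψ (-ᴹ‿inverseʳ x)) } }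

    -- V^K is finitely generated over A.
    FixedFinitelyGenerated : Pred Elem 0ℓ → Set
    FixedFinitelyGenerated K = ∃ λ r → ∃ λ (b : Fin r → Carrierᴹ) →
      (∀ i → Fixed (b i)) ×
      (∀ x → Fixed x → ∃ λ (a : Fin r → A.Carrier) → x ≈ᴹ sum (λ i → a i *ₗ b i))
      where
      open MonoidSum +ᴹ-commutativeMonoid using (sum)
      Fixed : Carrierᴹ → Set
      Fixed x = ∀ k → k ∈ K → k • x ≈ᴹ x

  record CoWhittaker (A : Algebra W) (V : SmoothRep (Algebra.ring A) Gₙ 0ℓ) : Set₁ where
    private module A = Algebra A
    field
      admissible    : ∀ K → LinearGroup.IsCompactOpenSubgroup Gₙ K → FixedFinitelyGenerated A V K
      freeOfRankOne : LinearIso (Coinvariants A V) (regular A.ring)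
      quotients     : (Q : SmoothRep A.ring Gₙ 0ℓ) (q : RepHom V Q) →
                      let open SmoothRep Q in
                      Surjective (SmoothRep._≈ᴹ_ V) _≈ᴹ_ (RepHom.⟦_⟧ q) →
                      (∀ x → _≈ψ_ A Q x 0ᴹ) → ∀ x → x ≈ᴹ 0ᴹ

  Zₙ : CommutativeRing 1ℓ 1ℓ
  Zₙ = centre W Gₙ

  blockCentre : (e : ∣ Zₙ ∣) → IsPrimitiveIdempotent Zₙ e → CommutativeRing 1ℓ 1ℓ
  blockCentre e prim = cornerRing Zₙ e (IsPrimitiveIdempotent.idempotent prim)

  module _ (A : Algebra W) (V : SmoothRep (Algebra.ring A) Gₙ 0ℓ) where
    private module A = Algebra A
    open Subalgebra using (algebra; subring)
    open SmoothRep V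
    private V|W = restrictRep A V

    InBlock : ∣ Zₙ ∣ → Set
    InBlock e = ∀ x → NatEnd._⟪_⟫ e V|W x ≈ᴹ x

    ActsThrough : (e : ∣ Zₙ ∣) (prim : IsPrimitiveIdempotent Zₙ e) → RingHom (blockCentre e prim) A.ring → Set₁
    ActsThrough e prim θ = ∀ z x → NatEnd._⟪_⟫ (proj₁ z) V|W x ≈ᴹ RingHomomorphism.⟦_⟧ θ z *ₗ x

    V⁽ⁿ⁾ : Mod A.ring 0ℓ
    V⁽ⁿ⁾ = Coinvariants A V

    -- Evaluation at 1 identifies (c-Ind_U^P ψ_M)⁽ⁿ⁾ with M, so the map induces
    -- the identity of M = V⁽ⁿ⁾ iff it sends each φ into the class φ(1).
    record BernsteinZelevinskyMap : Set₁ where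
      field
        map             : RepHom (c-Ind Pₙ A V⁽ⁿ⁾) (restrictToMirabolic V)
        inducesIdentity : ∀ φ → _≈ψ_ A V (RepHom.⟦_⟧ map φ) (IndFun.fun (proj₁ φ) (LinearGroup.ε Pₙ))

    module _ (f : LinearIso V⁽ⁿ⁾ (regular A.ring)) where
      private module f = LinearIso f
      open LinearGroup Gₙ

      whittaker : Carrierᴹ → IndFun Gₙ A (regular A.ring)
      whittaker v = record
        { fun         = λ g → f.⟦ g • v ⟧
        ; fun-cong    = λ g≈h → f.⟦⟧-cong (≈⇒≈ψ A V (•-cong g≈h ≈ᴹ-refl))
        ; equivariant = λ u g u∈ → A.trans
            (f.⟦⟧-cong (≈ψ-trans A V (≈⇒≈ψ A V (•-∙ u g v)) (generator u (g • v) u∈)))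
            (f.*ₗ-homo _ _)
        ; smooth      = open-if-stable (smooth v) (•-ε v)
            (λ {k} {k′} k≈k′ s g → A.trans (f.⟦⟧-cong (≈⇒≈ψ A V (•-cong (∙-congˡ {g} {k′} {k} (symᴳ {k} {k′} k≈k′)) ≈ᴹ-refl))) (s g))
            (λ k n s n∈ g → A.trans
              (f.⟦⟧-cong (≈⇒≈ψ A V
                (≈ᴹ-trans (•-cong (symᴳ {(g ∙ k) ∙ n} {g ∙ (k ∙ n)} (assoc g k n)) ≈ᴹ-refl)
                (≈ᴹ-trans (•-∙ (g ∙ k) n v) (•-cong (reflᴳ {g ∙ k}) n∈)))))
              (s g)) }

      -- c-Ind ψ_{A′} → c-Ind ψ_A ≅ c-Ind ψ_{V⁽ⁿ⁾} → V → Ind ψ_A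
      composite : (A′ : Subalgebra A) → BernsteinZelevinskyMap →
                  c-IndFun Pₙ (algebra A′) (regular (subring A′)) →
                  IndFun Gₙ A (regular A.ring)
      composite A′ β φ =
        whittaker (RepHom.⟦_⟧ (BernsteinZelevinskyMap.map β)
          (c-Ind-map Pₙ A (regular A.ring) A V⁽ⁿ⁾ (restrictLinear A f.inverse)
            (c-Ind-map Pₙ (algebra A′) (regular (subring A′)) A (regular A.ring) (inclusion A′) φ)))

      record ImageContained (A′ : Subalgebra A) (β : BernsteinZelevinskyMap) : Set₁ where
        field
          contained : ∀ φ →
            ∃ λ (h : IndFun Gₙ (algebra A′) (regular (subring A′))) →
            SmoothRep._≈ᴹ_ (Ind Gₙ A (regular A.ring)) (composite A′ β φ)
              (Ind-map Gₙ (algebra A′) (regular (subring A′)) A (regular A.ring) (inclusion A′) h)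

  FactorsThrough : (R : CommutativeRing a ℓa) (A : Algebra W) → Subalgebra A → RingHom R (Algebra.ring A) → Set (a ⊔ ℓa)
  FactorsThrough R A A′ θ =
    ∃ λ (θ′ : RingHom R (Subalgebra.subring A′)) →
    ∀ z → Algebra._≈_ A (RingHomomorphism.⟦_⟧ θ z) (proj₁ (RingHomomorphism.⟦_⟧ θ′ z))

module Submission where

-- Choose φ in c-Ind ψ_A′ supported on U·K, where K is a principal congruence
-- subgroup of P meeting U inside ker ψ, with φ(1) = 1, and let x be its image in
-- V, so that f x̄ = 1.  If z acts on V by θ(z), then θ(z) is the value at 1 of the
-- Whittaker function w(z x) = z w(x).  As w(x) comes from Ind ψ_A′ and z is natural
-- along the W-linear inclusion Ind ψ_A′ → Ind ψ_A, this value lies in A′.  The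
-- analytic input is the compactness of K, by which φ has compact support modulo U.

open import Level using (Level; 0ℓ; lift)
open import Axiom.ExcludedMiddle using (ExcludedMiddle)
open import Algebra.Bundles using (CommutativeMonoid; CommutativeRing)
open import Algebra.Morphism.Bundles using (RingHomomorphism)
import Algebra.Properties.CommutativeSemigroup as CSemigroupProps
import Algebra.Properties.Group as GroupProps
import Algebra.Properties.Ring as RingProps
import Algebra.Properties.Semiring.Sum as SemiringSum
open import Data.Empty using (⊥-elim)
open import Data.Fin.Base using (Fin; zero; suc; fromℕ; inject₁)
open import Data.Integer.Base as ℤ using (ℤ; +_; -[1+_])
import Data.Integer.Properties as ℤₚ
open import Data.List.Base using (List; []; _∷_; _++_; cartesianProduct; cartesianProductWith; concatMap; map)
open import Data.List.Relation.Unary.Any as Any using (Any; here; there)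
import Data.List.Relation.Unary.Any.Properties as Anyₚ
open import Data.Nat.Base as ℕ using (ℕ; zero; suc)
open import Data.Nat.Primality using (Prime)
import Data.Nat.Properties as ℕₚ
open import Data.Product.Base using (∃; _×_; _,_; proj₁; proj₂)
import Data.Vec.Functional as Vector
open import Function.Base using (_∘_)
open import Relation.Binary.Construct.Add.Supremum.NonStrict ℤ._≤_ using (_≤⁺_; [_]; _≤⊤⁺)
open import Relation.Binary.PropositionalEquality.Core as ≡ using (_≡_; _≢_)
import Relation.Binary.Reasoning.Setoid as SetoidReasoning
open import Relation.Nullary.Construct.Add.Supremum using (_⁺; ⊤⁺; [_])
open import Relation.Nullary.Decidable.Core using (Dec; yes; no)
open import Relation.Nullary.Negation.Core using (¬_; contradiction)
open import Relation.Unary using (Pred; _∈_; _⊆_; _∩_)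
open import Defs

-- Classical choice and a covering form of compactness

module Classical (em : ExcludedMiddle 1ℓ) where

  decide : (P : Set) → Dec P
  decide P with em {Level.Lift 1ℓ P}
  ... | yes (lift p) = yes p
  ... | no ¬p        = no (¬p ∘ lift)

  -- A decision of ∃ P carries a witness, so excluded middle yields choice.
  ∄¬⇒∀ : {A : Set} {P : Pred A 0ℓ} → ¬ (∃ λ x → ¬ P x) → ∀ x → P x
  ∄¬⇒∀ {P = P} ∄ x with decide (P x)
  ... | yes p = p
  ... | no ¬p = contradiction (x , ¬p) ∄

  -- König's lemma: if no finite subcover exists, then subdividing repeatedly gives
  -- decreasing subsets Kₙ, shrinking in diameter, without finite subcover, yet the
  -- limit of points of the Kₙ has a neighbourhood contained in one O i.
  module König
    {X C : Set} (K : Pred X 0ℓ) (Close : ℕ → X → X → Set) (Ball : ℕ → C → Pred X 0ℓ)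
    (Close-sym   : ∀ {n x y} → Close n x y → Close n y x)
    (Close-trans : ∀ {n x y z} → Close n x y → Close n y z → Close n x z)
    (Close-mono  : ∀ {m n x y} → m ℕ.≤ n → Close n x y → Close m x y)
    (Ball-small  : ∀ {n c x y} → x ∈ Ball n c → y ∈ Ball n c → Close n x y)
    (bounded     : ∀ n → ∃ λ cs → ∀ x → x ∈ K → Any (λ c → x ∈ Ball n c) cs)
    (complete    : (s : ℕ → X) → (∀ n → s n ∈ K) →
                   (∀ n i j → n ℕ.≤ i → n ℕ.≤ j → Close n (s i) (s j)) →
                   ∃ λ x → x ∈ K × ∀ n → ∃ λ i → n ℕ.≤ i × Close n (s i) x)
    {I : Set} (O : I → Pred X 0ℓ)
    (O-open      : ∀ i x → x ∈ O i → ∃ λ n → ∀ y → Close n x y → y ∈ O i)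
    (O-covers    : ∀ x → x ∈ K → ∃ λ i → x ∈ O i)
    where

    FinitelyCovered : Pred X 0ℓ → Set
    FinitelyCovered T = ∃ λ is → ∀ x → x ∈ T → Any (λ i → x ∈ O i) is

    -- The index lists for the balls in `cs` are concatenated. With total boundedness, `T` itself
    -- would be finitely covered if each of its pieces were, which is the contradiction behind
    -- `part`.
    covered-∪ : ∀ {n T} → (∀ c → FinitelyCovered (T ∩ Ball n c)) → ∀ cs →
                FinitelyCovered (T ∩ λ x → Any (λ c → x ∈ Ball n c) cs)
    covered-∪ h []       = [] , λ _ ()
    covered-∪ h (c ∷ cs) =
      let is , p = h c ; js , q = covered-∪ h cs in
      is ++ js , λ where
        x (t , here b)  → Anyₚ.++⁺ˡ (p x (t , b))
        x (t , there b) → Anyₚ.++⁺ʳ is (q x (t , b))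

    record Uncovered : Set₁ where
      field
        set       : Pred X 0ℓ
        ⊆K        : set ⊆ K
        uncovered : ¬ FinitelyCovered set
    open Uncovered

    part : ∀ n (T : Uncovered) → ∃ λ c → ¬ FinitelyCovered (set T ∩ Ball n c)
    part n T with decide (∃ λ c → ¬ FinitelyCovered (set T ∩ Ball n c))
    ... | yes p = p
    ... | no ∄  = contradiction
      (let cs , k = bounded n ; is , h = covered-∪ (∄¬⇒∀ ∄) cs in
       is , λ x t → h x (t , k x (⊆K T t)))
      (uncovered T)

    point : (T : Uncovered) → ∃ λ x → x ∈ set T
    point T with decide (∃ λ x → x ∈ set T)
    ... | yes p = p
    ... | no ∄  = contradiction ([] , λ x t → contradiction (x , t) ∄) (uncovered T)

    module _ (¬fin : ¬ FinitelyCovered K) where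

      stage : ℕ → Uncovered
      stage zero    = record { set = K ; ⊆K = λ k → k ; uncovered = ¬fin }
      stage (suc n) = record
        { set       = set (stage n) ∩ Ball n (proj₁ (part n (stage n)))
        ; ⊆K        = ⊆K (stage n) ∘ proj₁
        ; uncovered = proj₂ (part n (stage n)) }

      stage-anti : ∀ {m n} → m ℕ.≤′ n → set (stage n) ⊆ set (stage m)
      stage-anti ℕ.≤′-refl     t = t
      stage-anti (ℕ.≤′-step p) t = stage-anti p (proj₁ t)

      -- The ball of precision `n` is cut out only in passing to stage `suc n`; the shift puts
      -- `seq i` in that ball for every `i` from `n` on.
      seq : ℕ → X
      seq n = proj₁ (point (stage (suc n)))

      seq∈ : ∀ n → seq n ∈ set (stage (suc n))
      seq∈ n = proj₂ (point (stage (suc n)))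

      seq∈Ball : ∀ n i → n ℕ.≤ i → seq i ∈ Ball n (proj₁ (part n (stage n)))
      seq∈Ball n i n≤i = proj₂ (stage-anti (ℕₚ.≤⇒≤′ (ℕ.s≤s n≤i)) (seq∈ i))

      covered-stage : ∃ λ n → FinitelyCovered (set (stage n))
      covered-stage =
        let x , x∈K , lim = complete seq (λ n → ⊆K (stage (suc n)) (seq∈ n))
              (λ n i j n≤i n≤j → Ball-small (seq∈Ball n i n≤i) (seq∈Ball n j n≤j))
            i , x∈O       = O-covers x x∈K
            n , near      = O-open i x x∈O
            k , n≤k , s→x = lim n
        -- Stage `suc k` lies in a single ball of precision `k`, which also contains `seq k`; as
        -- `seq k` is near the limit, the whole stage falls inside `O i`.
        in suc k , i ∷ [] , λ y y∈ → here (near y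
             (Close-trans (Close-sym s→x) (Close-mono n≤k (Ball-small (proj₂ (seq∈ k)) (proj₂ y∈)))))

    compact : FinitelyCovered K
    compact with decide (FinitelyCovered K)
    ... | yes p   = p
    ... | no ¬fin = let n , fin = covered-stage ¬fin in contradiction fin (uncovered (stage ¬fin n))

-- Finite lists of approximations for each coordinate multiply into one for tuples. Used twice, this
-- passes from field elements to rows and from rows to matrices.
finiteCover-→ : {A B : Set} {D : Pred A 0ℓ} {R : A → B → Set} →
                (∃ λ bs → ∀ x → x ∈ D → Any (R x) bs) → ∀ n →
                ∃ λ (fs : List (Fin n → B)) → ∀ (g : Fin n → A) → (∀ i → g i ∈ D) → Any (λ f → ∀ i → R (g i) (f i)) fs
finiteCover-→ c zero = Vector.[] ∷ [] , λ _ _ → here λ ()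
finiteCover-→ {R = R} c@(bs , h) (suc n) =
  let fs , k = finiteCover-→ {R = R} c n in
  cartesianProductWith Vector._∷_ bs fs , λ g g∈ →
    Anyₚ.cartesianProductWith⁺ Vector._∷_ (λ { r s zero → r ; r s (suc i) → s i })
      (h (g zero) (g∈ zero)) (k (g ∘ suc) (g∈ ∘ suc))

-- Congruences modulo powers of the maximal ideal

module Congruence {p : ℕ} (F : PAdicField p) where
  open PAdicField F
  open RingProps (CommutativeRing.ring ring)
    using (-1*x≈-x; -‿involutive; -‿+-comm; -‿distribˡ-*; -‿distribʳ-*; ⁻¹-anti-homo-//; -0#≈0#; //-rightDividesˡ)
  open CSemigroupProps (CommutativeMonoid.commutativeSemigroup +-commutativeMonoid) using (interchange)
  open SemiringSum semiring using (sum)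

  -- Here v(x²) = 2v(x), so a negative valuation stays negative. This gives integrality of -1, whose
  -- square is 1.
  integral-√ : ∀ {x} → x * x ∈𝔭^ + 0 → x ∈𝔭^ + 0
  integral-√ {x} xx∈ with v x | ≡.subst ([ + 0 ] ≤⁺_) (v-* x x) xx∈
  ... | ⊤⁺          | _      = _ ≤⊤⁺
  ... | [ + n ]     | _      = [ ℤ.+≤+ ℕ.z≤n ]
  ... | [ -[1+ n ] ] | [ () ]

  -- From 1 = 1 · 1 follows v(1) = 2v(1), which no negative integer satisfies.
  1∈𝔭⁰ : 1# ∈𝔭^ + 0
  1∈𝔭⁰ with v 1# | ≡.trans (v-cong (sym (*-identityˡ 1#))) (v-* 1# 1#)
  ... | ⊤⁺           | _  = _ ≤⊤⁺
  ... | [ + n ]      | _  = [ ℤ.+≤+ ℕ.z≤n ]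
  ... | [ -[1+ n ] ] | eq = ⊥-elim (ℕₚ.m≢1+m+n n (neg-injective eq))
    where
    neg-injective : ∀ {m n} → _≡_ {A = ℤ ⁺} [ -[1+ m ] ] [ -[1+ n ] ] → m ≡ n
    neg-injective ≡.refl = ≡.refl

  neg-∈𝔭 : ∀ {m x} → x ∈𝔭^ m → - x ∈𝔭^ m
  neg-∈𝔭 {m} {x} x∈ = ∈𝔭-resp (-1*x≈-x x)
    (≡.subst (- 1# * x ∈𝔭^_) (ℤₚ.+-identityˡ m) (*-∈𝔭 (integral-√ -1²∈) x∈))
    where
    -1²∈ : - 1# * - 1# ∈𝔭^ + 0
    -1²∈ = ∈𝔭-resp (sym (trans (-1*x≈-x (- 1#)) (-‿involutive 1#))) 1∈𝔭⁰

  integral-*ˡ : ∀ {m x y} → x ∈𝔭^ + 0 → y ∈𝔭^ m → x * y ∈𝔭^ m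
  integral-*ˡ {m} x∈ y∈ = ≡.subst (_ ∈𝔭^_) (ℤₚ.+-identityˡ m) (*-∈𝔭 x∈ y∈)

  ∈𝔭-separated : ∀ {x} → (∀ n → x ∈𝔭^ + n) → x ≈ 0#
  ∈𝔭-separated {x} h = v-⊤⁺ (go h)
    where
    go : ∀ {i} → (∀ n → [ + n ] ≤⁺ i) → i ≡ ⊤⁺
    go {⊤⁺}          _ = ≡.refl
    go {[ + n ]}     h with h (suc n)
    ... | [ ℤ.+≤+ n<n ] = contradiction n<n (ℕₚ.<-irrefl ≡.refl)
    go {[ -[1+ n ] ]} h with h 0
    ... | [ () ]

  infix 4 _∼[_]_
  _∼[_]_ : Carrier → ℤ → Carrier → Set
  x ∼[ m ] y = x - y ∈𝔭^ m

  ≈⇒∼ : ∀ {m x y} → x ≈ y → x ∼[ m ] y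
  ≈⇒∼ {y = y} x≈y = 0∈𝔭 (trans (+-congʳ x≈y) (-‿inverseʳ y))

  ∼-sym : ∀ {m x y} → x ∼[ m ] y → y ∼[ m ] x
  ∼-sym {x = x} {y} h = ∈𝔭-resp (⁻¹-anti-homo-// x y) (neg-∈𝔭 h)

  ∼-trans : ∀ {m x y z} → x ∼[ m ] y → y ∼[ m ] z → x ∼[ m ] z
  ∼-trans {x = x} {y} {z} h k = ∈𝔭-resp
    (trans (sym (+-assoc (x - y) y (- z))) (+-congʳ (//-rightDividesˡ y x))) (v-+ _ _ h k)

  ∼-+ : ∀ {m x x′ y y′} → x ∼[ m ] y → x′ ∼[ m ] y′ → x + x′ ∼[ m ] y + y′
  ∼-+ {x = x} {x′} {y} {y′} h k = ∈𝔭-resp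
    (trans (interchange x (- y) x′ (- y′)) (+-congˡ (-‿+-comm y y′))) (v-+ _ _ h k)

  ∼-*ˡ : ∀ {k m x y} z → z ∈𝔭^ k → x ∼[ m ] y → z * x ∼[ k ℤ.+ m ] z * y
  ∼-*ˡ {x = x} {y} z z∈ h = ∈𝔭-resp
    (trans (distribˡ z x (- y)) (+-congˡ (sym (-‿distribʳ-* z y)))) (*-∈𝔭 z∈ h)

  -- By xx′ - yy′ = (x - y)x′ + y(x′ - y′), integrality is needed only of `x′` and `y`.
  ∼-* : ∀ {m x x′ y y′} → x′ ∈𝔭^ + 0 → y ∈𝔭^ + 0 → x ∼[ m ] y → x′ ∼[ m ] y′ → x * x′ ∼[ m ] y * y′
  ∼-* {m} {x} {x′} {y} {y′} x′∈ y∈ h k = ∼-trans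
    (∈𝔭-resp (trans (distribʳ x′ x (- y)) (+-congˡ (sym (-‿distribˡ-* y x′))))
      (∈𝔭-resp (*-comm x′ (x - y)) (integral-*ˡ x′∈ h)))
    (≡.subst (y * x′ ∼[_] y * y′) (ℤₚ.+-identityˡ m) (∼-*ˡ y y∈ k))

  ∼-sum : ∀ {m n} (f g : Fin n → Carrier) → (∀ i → f i ∼[ m ] g i) → sum f ∼[ m ] sum g
  ∼-sum {n = zero}  f g h = ≈⇒∼ refl
  ∼-sum {n = suc n} f g h = ∼-+ (h zero) (∼-sum (f ∘ suc) (g ∘ suc) (h ∘ suc))

  ∈𝔭⇒∼0 : ∀ {m x} → x ∈𝔭^ m → x ∼[ m ] 0#
  ∈𝔭⇒∼0 {x = x} = ∈𝔭-resp (sym (trans (+-congˡ -0#≈0#) (+-identityʳ x)))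

  ∼-∈𝔭 : ∀ {m x y} → x ∼[ m ] y → y ∈𝔭^ m → x ∈𝔭^ m
  ∼-∈𝔭 {x = x} {y} h y∈ = ∈𝔭-resp (//-rightDividesˡ y x) (v-+ _ _ h y∈)

  ∼-separated : ∀ {x y} → (∀ n → x ∼[ + n ] y) → x ≈ y
  ∼-separated {x} {y} h =
    trans (sym (//-rightDividesˡ y x)) (trans (+-congʳ (∈𝔭-separated h)) (+-identityˡ y))

  -- The witnesses are the `n`-th powers of a uniformizer and of its inverse. They rescale between
  -- 𝔭ⁿ and the ring of integers.
  ϖ^ : ∀ n → ∃ λ a → ∃ λ b → a ∈𝔭^ + n × b ∈𝔭^ (ℤ.- + n) × a * b ≈ 1#
  ϖ^ zero    = 1# , 1# , 1∈𝔭⁰ , 1∈𝔭⁰ , *-identityˡ 1#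
  ϖ^ (suc n) =
    let a , b , a∈ , b∈ , ab≈1 = ϖ^ n
        ϖ , vϖ                 = uniformizer
        c , ϖc≈1               = IsField.inverse isField ϖ (ϖ≉0 vϖ)
    in ϖ * a , c * b ,
       *-∈𝔭 {+ 1} (≡.subst ([ + 1 ] ≤⁺_) (≡.sym vϖ) [ ℤₚ.≤-refl ]) a∈ ,
       ≡.subst (c * b ∈𝔭^_) (≡.sym (ℤₚ.neg-distrib-+ (+ 1) (+ n))) (*-∈𝔭 {ℤ.- + 1} (inverse∈ vϖ ϖc≈1) b∈) ,
       trans (*-interchange ϖ a c b) (trans (*-cong ϖc≈1 ab≈1) (*-identityˡ 1#))
    where
    open CSemigroupProps *-commutativeSemigroup renaming (interchange to *-interchange)

    ϖ≉0 : ∀ {ϖ} → v ϖ ≡ [ + 1 ] → ϖ ≉ 0#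
    ϖ≉0 vϖ ϖ≈0 with ≡.trans (≡.sym vϖ) (≡.trans (v-cong ϖ≈0) v-0#)
    ... | ()

    inverse∈ : ∀ {ϖ c} → v ϖ ≡ [ + 1 ] → ϖ * c ≈ 1# → c ∈𝔭^ (ℤ.- + 1)
    inverse∈ {ϖ} {c} vϖ e = go (≡.subst ([ + 0 ] ≤⁺_)
      (≡.trans (v-cong (sym e)) (≡.trans (v-* ϖ c) (≡.cong (_+⁺ v c) vϖ))) 1∈𝔭⁰)
      where
      go : ∀ {i} → [ + 0 ] ≤⁺ [ + 1 ] +⁺ i → [ ℤ.- + 1 ] ≤⁺ i
      go {⊤⁺}              _ = _ ≤⊤⁺
      go {[ + n ]}          _ = [ ℤ.-≤+ ]
      go {[ -[1+ 0 ] ]}     _ = [ ℤₚ.≤-refl ]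
      go {[ -[1+ suc n ] ]} [ () ]

  -- Digit expansion: if x ≡ c mod 𝔭ⁿ, then ϖ⁻ⁿ(x - c) is integral, and a representative `r` of its
  -- residue class supplies the next digit, x ≡ c + ϖⁿr mod 𝔭ⁿ⁺¹.
  totallyBounded : ∀ n → ∃ λ cs → ∀ x → x ∈𝔭^ + 0 → Any (x ∼[ + n ]_) cs
  totallyBounded zero    = 0# ∷ [] , λ x x∈ → here (∈𝔭⇒∼0 x∈)
  totallyBounded (suc n) =
    let cs , cover              = totallyBounded n
        rs , residues           = residueFinite
        a , b , a∈ , b∈ , ab≈1 = ϖ^ n
    in concatMap (λ c → map (λ r → c + a * r) rs) cs , λ x x∈ →
       Anyₚ.concat⁺ (Anyₚ.map⁺ (Any.map (λ {c} x∼c →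
         Anyₚ.map⁺ (Any.map (λ {r} → refine a∈ ab≈1) (residues (b * (x - c)) (cancel-∈𝔭ˡ {0} {n} b∈ x∼c))))
         (cover x x∈)))
    where
    refine : ∀ {a b x c r} → a ∈𝔭^ + n → a * b ≈ 1# → b * (x - c) ∼[ + 1 ] r → x ∼[ + suc n ] c + a * r
    refine {a} {b} {x} {c} {r} a∈ ab≈1 y∼r = ∼-trans
      (≈⇒∼ (trans (sym (//-rightDividesˡ c x)) (trans (+-comm (x - c) c)
        (+-congˡ (trans (sym (*-identityˡ (x - c))) (trans (*-congʳ (sym ab≈1)) (*-assoc a b (x - c))))))))
      (∼-+ (≈⇒∼ refl) (≡.subst (a * (b * (x - c)) ∼[_] a * r) (≡.cong +_ (ℕₚ.+-comm n 1)) (∼-*ˡ a a∈ y∼r)))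

eventually-∀ : ∀ {n} {Q : Fin n → ℕ → Set} → (∀ i → ∃ λ M → ∀ k → M ℕ.≤ k → Q i k) →
               ∃ λ M → ∀ k → M ℕ.≤ k → ∀ i → Q i k
eventually-∀ {zero}  h = 0 , λ _ _ ()
eventually-∀ {suc n} h =
  let a , p = h zero
      b , q = eventually-∀ (h ∘ suc)
  in a ℕ.⊔ b , λ where
    k M≤k zero    → p k (ℕₚ.≤-trans (ℕₚ.m≤m⊔n a b) M≤k)
    k M≤k (suc i) → q k (ℕₚ.≤-trans (ℕₚ.m≤n⊔m a b) M≤k) i

-- Principal congruence subgroups of the mirabolic and their compactness

module CongruenceSubgroup {p : ℕ} (F : PAdicField p) where
  open PAdicField F
  open Congruence F
  open LinearGroups F
  open SemiringSum semiring using (sum)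

  Integral : ∀ {n} → Matrix n → Set
  Integral x = ∀ i j → x i j ∈𝔭^ + 0

  infix 4 _≋[_]_
  _≋[_]_ : ∀ {n} → Matrix n → ℕ → Matrix n → Set
  x ≋[ N ] y = ∀ i j → x i j ∼[ + N ] y i j

  ≋-sym : ∀ {l n} {x y : Matrix l} → x ≋[ n ] y → y ≋[ n ] x
  ≋-sym h i j = ∼-sym (h i j)

  ≋-trans : ∀ {l n} {x y z : Matrix l} → x ≋[ n ] y → y ≋[ n ] z → x ≋[ n ] z
  ≋-trans h k i j = ∼-trans (h i j) (k i j)

  ≋-mono : ∀ {l n n′} {x y : Matrix l} → n ℕ.≤ n′ → x ≋[ n′ ] y → x ≋[ n ] y
  ≋-mono n≤n′ h i j = ∈𝔭-mono (ℤ.+≤+ n≤n′) (h i j)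

  ≋-separated : ∀ {l} {x y : Matrix l} → (∀ n → x ≋[ n ] y) → x ≈ₘ y
  ≋-separated h i j = ∼-separated λ n → h n i j

  1ₘ-integral : ∀ {n} → Integral (1ₘ {n})
  1ₘ-integral zero    zero    = 1∈𝔭⁰
  1ₘ-integral zero    (suc j) = 0∈𝔭 refl
  1ₘ-integral (suc i) zero    = 0∈𝔭 refl
  1ₘ-integral (suc i) (suc j) = 1ₘ-integral i j

  ≋1⇒Integral : ∀ {n N} {x : Matrix n} → x ≋[ N ] 1ₘ → Integral x
  ≋1⇒Integral h i j = ∼-∈𝔭 (∈𝔭-mono (ℤ.+≤+ ℕ.z≤n) (h i j)) (1ₘ-integral i j)

  ≋-*ₘ : ∀ {n N} (x x′ y y′ : Matrix n) → Integral x′ → Integral y →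
         x ≋[ N ] y → x′ ≋[ N ] y′ → x *ₘ x′ ≋[ N ] y *ₘ y′
  ≋-*ₘ x x′ y y′ x′∈ y∈ h k i j =
    ∼-sum (λ l → x i l * x′ l j) (λ l → y i l * y′ l j) λ l → ∼-* (x′∈ l j) (y∈ i l) (h i l) (k l j)

  ≋-limit : ∀ {l} (s : ℕ → Matrix l) →
            (∀ n i j → n ℕ.≤ i → n ℕ.≤ j → s i ≋[ n ] s j) →
            ∃ λ x → ∀ n → ∃ λ M → ∀ k → M ℕ.≤ k → s k ≋[ n ] x
  ≋-limit s cauchy =
    (λ i j → proj₁ (entry i j)) ,
    λ n → eventually-∀ λ i → eventually-∀ λ j → proj₂ (entry i j) n
    where
    entry : ∀ i j → _
    entry i j = complete (λ k → s k i j) λ n → n , λ k l n≤k n≤l → cauchy n k l n≤k n≤l i j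

  -- Multiplication of integral matrices respects congruences, so the product of the limits is
  -- congruent to 1 modulo every 𝔭ⁿ, and separatedness gives equality.
  limit-*ₘ : ∀ {l} (s t : ℕ → Matrix l) (x y : Matrix l) →
             (∀ n → ∃ λ k → Integral (t k) × Integral x × s k ≋[ n ] x × t k ≋[ n ] y × s k *ₘ t k ≈ₘ 1ₘ) →
             x *ₘ y ≈ₘ 1ₘ
  limit-*ₘ s t x y h = ≋-separated λ n i j →
    let k , t∈ , x∈ , s→x , t→y , st≈1 = h n in
    ∼-trans (∼-sym (≋-*ₘ (s k) (t k) x y t∈ x∈ s→x t→y i j)) (≈⇒∼ (st≈1 i j))

  *ₘ-≋1 : ∀ {n N} (x y : Matrix n) → x ≋[ N ] 1ₘ → y ≋[ N ] 1ₘ → x *ₘ y ≋[ N ] 1ₘ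
  *ₘ-≋1 x y h k i j = ∼-trans
    (≋-*ₘ x y 1ₘ 1ₘ (≋1⇒Integral k) 1ₘ-integral h k i j) (≈⇒∼ (*ₘ-identityˡ 1ₘ i j))

  uniformBound : ∀ {m n} (x : Fin m → Fin n → Carrier) → ∃ λ b → ∀ i j → x i j ∈𝔭^ (ℤ.- + b)
  uniformBound {zero}  x = 0 , λ ()
  uniformBound {suc m} x =
    let b , h = boundedFamily (x zero)
        c , k = uniformBound (x ∘ suc)
    in b ℕ.⊔ c , λ where
      zero    j → ∈𝔭-mono (ℤₚ.neg-mono-≤ (ℤ.+≤+ (ℕₚ.m≤m⊔n b c))) (h j)
      (suc i) j → ∈𝔭-mono (ℤₚ.neg-mono-≤ (ℤ.+≤+ (ℕₚ.m≤n⊔m b c))) (k i j)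

  -- If y x = 1 with x ≡ 1 mod 𝔭ᴺ, then y − 1 ≡ y − y x gains N powers of 𝔭 over y.
  leftInverse-≋1 : ∀ {n N} (x y : Matrix n) → y *ₘ x ≈ₘ 1ₘ → x ≋[ suc N ] 1ₘ → y ≋[ suc N ] 1ₘ
  leftInverse-≋1 {n} {N} x y yx≈1 x≋1 =
    let b , y∈ = uniformBound y in gain 0 (reduce b y∈)
    where
    gain : ∀ b → (∀ i j → y i j ∈𝔭^ (ℤ.- + b)) → ∀ i j → y i j ∼[ ℤ.- + b ℤ.+ + suc N ] 1ₘ i j
    gain b y∈ i j = ∼-trans (≈⇒∼ (sym (*ₘ-identityʳ y i j))) (∼-trans
      (∼-sum (λ l → y i l * 1ₘ l j) (λ l → y i l * x l j) λ l → ∼-*ˡ (y i l) (y∈ i l) (∼-sym (x≋1 l j)))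
      (≈⇒∼ (yx≈1 i j)))

    reduce : ∀ b → (∀ i j → y i j ∈𝔭^ (ℤ.- + b)) → Integral y
    reduce zero    y∈ = y∈
    -- The exponent `suc N` is positive, so each use of `gain` improves the bound on the
    -- denominators of `y` by at least one power; after finitely many uses `y` is integral, and one
    -- more gives the congruence.
    reduce (suc b) y∈ = reduce b λ i j → ∼-∈𝔭
      (∈𝔭-mono (≡.subst (ℤ.- + b ℤ.≤_) (≡.sym (ℤₚ.[1+m]⊖[1+n]≡m⊖n N b)) (-b≤N⊖b b)) (gain (suc b) y∈ i j))
      (∈𝔭-mono (ℤₚ.neg-mono-≤ (ℤ.+≤+ ℕ.z≤n)) (1ₘ-integral i j))
      where
      -b≤N⊖b : ∀ b → ℤ.- + b ℤ.≤ N ℤ.⊖ b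
      -b≤N⊖b zero    = ℤ.+≤+ ℕ.z≤n
      -b≤N⊖b (suc b) = ℤₚ.-[1+m]≤n⊖m+1 b N

  module _ (m N : ℕ) where
    private module P = LinearGroup (Mirabolic m)
    open InvertibleMatrix

    -- The level is `suc N` because `leftInverse-≋1`, and with it closure under inverses, requires a
    -- positive level.
    K : Pred P.Elem 0ℓ
    K g = P.matrix g ≋[ suc N ] 1ₘ

    ε∈K : P.ε ∈ K
    ε∈K i j = ≈⇒∼ refl

    K-∙ : ∀ {g h} → g ∈ K → h ∈ K → g P.∙ h ∈ K
    K-∙ {g} {h} = *ₘ-≋1 (P.matrix g) (P.matrix h)

    K-⁻¹ : ∀ {g} → g ∈ K → g P.⁻¹ ∈ K
    K-⁻¹ {g , _} = leftInverse-≋1 (mat g) (inv g) (inverseˡ g)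

    K-open : P.IsOpen K
    K-open g g∈ = suc N , λ h g~h i j → ∼-trans (g~h i j) (g∈ i j)

    -- Inverses are approximated along with the matrices, so that the limit of a
    -- Cauchy sequence is invertible without any appeal to determinants.
    Close : ℕ → P.Elem → P.Elem → Set
    Close n (g , _) (h , _) = mat g ≋[ n ] mat h × inv g ≋[ n ] inv h

    Ball : ℕ → Matrix (suc m) × Matrix (suc m) → Pred P.Elem 0ℓ
    Ball n (x , y) (g , _) = mat g ≋[ n ] x × inv g ≋[ n ] y

    -- Elements of `K` and their inverses are both integral, so pairs drawn from one finite list of
    -- matrices approximate both at once.
    K-bounded : ∀ n → ∃ λ cs → ∀ g → g ∈ K → Any (λ c → g ∈ Ball n c) cs
    K-bounded n =
      let xs , cover = finiteCover-→ (finiteCover-→ (totallyBounded n) (suc m)) (suc m)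
      in cartesianProduct xs xs , λ g g∈ → Anyₚ.cartesianProductWith⁺ _,_ _,_
           (cover (mat (proj₁ g)) (≋1⇒Integral g∈))
           (cover (inv (proj₁ g)) (≋1⇒Integral (K-⁻¹ {g} g∈)))

    -- Matrices and inverses converge entrywise to `x` and `y`, and the inverse relations pass to
    -- the limit by `limit-*ₘ`. Congruence to 1 and the shape of the last row are closed conditions.
    K-complete : (s : ℕ → P.Elem) → (∀ n → s n ∈ K) →
                 (∀ n i j → n ℕ.≤ i → n ℕ.≤ j → Close n (s i) (s j)) →
                 ∃ λ g → g ∈ K × ∀ n → ∃ λ k → n ℕ.≤ k × Close n (s k) g
    K-complete s s∈K cauchy = g , x≋1 , λ n →
      let k , n≤k , s→x , t→y = near n in k , n≤k , s→x , t→y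
      where
      t t⁻¹ : ℕ → Matrix (suc m)
      t n   = mat (proj₁ (s n))
      t⁻¹ n = inv (proj₁ (s n))
      X = ≋-limit t λ n i j n≤i n≤j → proj₁ (cauchy n i j n≤i n≤j)
      Y = ≋-limit t⁻¹ λ n i j n≤i n≤j → proj₂ (cauchy n i j n≤i n≤j)
      x = proj₁ X
      y = proj₁ Y

      near : ∀ n → ∃ λ k → n ℕ.≤ k × t k ≋[ n ] x × t⁻¹ k ≋[ n ] y
      near n =
        let a , h = proj₂ X n
            b , h′ = proj₂ Y n
            k = n ℕ.⊔ (a ℕ.⊔ b)
            a⊔b≤k = ℕₚ.m≤n⊔m n (a ℕ.⊔ b)
        in k , ℕₚ.m≤m⊔n n (a ℕ.⊔ b) ,
           h k (ℕₚ.≤-trans (ℕₚ.m≤m⊔n a b) a⊔b≤k) , h′ k (ℕₚ.≤-trans (ℕₚ.m≤n⊔m a b) a⊔b≤k)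

      x≋1 : x ≋[ suc N ] 1ₘ
      x≋1 = let k , _ , s→x , _ = near (suc N) in ≋-trans (≋-sym s→x) (s∈K k)

      t⁻¹≋1 : ∀ k → t⁻¹ k ≋[ suc N ] 1ₘ
      t⁻¹≋1 k = K-⁻¹ {s k} (s∈K k)

      y≋1 : y ≋[ suc N ] 1ₘ
      y≋1 = let k , _ , _ , t→y = near (suc N) in ≋-trans (≋-sym t→y) (t⁻¹≋1 k)

      g : P.Elem
      g = record
        { mat      = x
        ; inv      = y
        ; inverseˡ = limit-*ₘ t⁻¹ t y x λ n → let k , _ , t→x , t→y = near n in
            k , ≋1⇒Integral (s∈K k) , ≋1⇒Integral y≋1 , t→y , t→x , inverseˡ (proj₁ (s k))
        ; inverseʳ = limit-*ₘ t t⁻¹ x y λ n → let k , _ , t→x , t→y = near n in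
            k , ≋1⇒Integral (t⁻¹≋1 k) , ≋1⇒Integral x≋1 , t→x , t→y , inverseʳ (proj₁ (s k)) } ,
        λ j → ∼-separated λ n → let k , _ , t→x , _ = near n in
          ∼-trans (∼-sym (t→x (fromℕ m) j)) (≈⇒∼ (proj₂ (s k) j))

    -- `Close` refines nearness of matrices, so sets open in the matrix topology are open for it,
    -- and König's lemma applies to every open cover, in particular to the `H`-stable ones.
    K-compact : ∀ {H} → ExcludedMiddle 1ℓ → P.IsCompactModulo H K
    K-compact em O O-open _ O-covers = Classical.König.compact em K Close Ball
      (λ (h , k) → ≋-sym h , ≋-sym k)
      (λ (h , k) (h′ , k′) → ≋-trans h h′ , ≋-trans k k′)
      (λ m≤n (h , k) → ≋-mono m≤n h , ≋-mono m≤n k)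
      (λ (h , k) (h′ , k′) → ≋-trans h (≋-sym h′) , ≋-trans k (≋-sym k′))
      K-bounded K-complete O
      (λ i g g∈ → let n , near = O-open i g g∈ in n , λ h g~h → near h (≋-sym (proj₁ g~h)))
      O-covers

-- Unipotent upper triangular matrices, by induction on the lower right block

module Unipotent {p : ℕ} (F : PAdicField p) where
  open PAdicField F
  open LinearGroups F
  open SemiringSum semiring using (sum; sum-cong-≋)
  open CSemigroupProps (CommutativeMonoid.commutativeSemigroup +-commutativeMonoid) using (interchange)

  minor : ∀ {n} → Matrix (suc n) → Matrix n
  minor x i j = x (suc i) (suc j)

  minor-unipotent : ∀ {n} {x : Matrix (suc n)} → IsUnipotentUpper x → IsUnipotentUpper (minor x)
  minor-unipotent (d , l) = (d ∘ suc) , λ i j j<i → l (suc i) (suc j) (ℕ.s≤s j<i)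

  block-unipotent : ∀ {n} {x : Matrix (suc n)} → x zero zero ≈ 1# → (∀ i → x (suc i) zero ≈ 0#) →
                    IsUnipotentUpper (minor x) → IsUnipotentUpper x
  block-unipotent x₀₀ xₛ₀ (d , l) =
    (λ { zero → x₀₀ ; (suc i) → d i }) ,
    λ { (suc i) zero j<i → xₛ₀ i ; (suc i) (suc j) (ℕ.s≤s j<i) → l i j j<i }

  unipotent-resp : ∀ {n} {x y : Matrix n} → x ≈ₘ y → IsUnipotentUpper x → IsUnipotentUpper y
  unipotent-resp x≈y (d , l) =
    (λ i → trans (sym (x≈y i i)) (d i)) , λ i j j<i → trans (sym (x≈y i j)) (l i j j<i)

  1ₘ-unipotent : ∀ {n} → IsUnipotentUpper (1ₘ {n})
  1ₘ-unipotent {zero}  = (λ ()) , λ ()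
  1ₘ-unipotent {suc n} = block-unipotent refl (λ _ → refl) 1ₘ-unipotent

  module _ {n : ℕ} {u : Matrix (suc n)} (u∈ : IsUnipotentUpper u) where

    firstRow-sum : ∀ (x : Fin (suc n) → Carrier) → (∀ l → x (suc l) ≈ 0#) → sum (λ l → u zero l * x l) ≈ x zero
    firstRow-sum x x₊≈0 = trans
      (+-cong (trans (*-congʳ (proj₁ u∈ zero)) (*-identityˡ _))
              (sum-zero (λ l → u zero (suc l) * x (suc l)) λ l → trans (*-congˡ (x₊≈0 l)) (zeroʳ _)))
      (+-identityʳ _)

    lowerRow-sum : ∀ i (x : Fin (suc n) → Carrier) → sum (λ l → u (suc i) l * x l) ≈ sum (λ l → u (suc i) (suc l) * x (suc l))
    lowerRow-sum i x = trans
      (+-congʳ (trans (*-congʳ (proj₂ u∈ (suc i) zero (ℕ.s≤s ℕ.z≤n))) (zeroˡ _))) (+-identityˡ _)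

  -- Back substitution: the lower rows involve only the tail of `x`, which vanishes by induction,
  -- and then the first row reads `x zero`.
  unipotent-injective : ∀ {n} {u : Matrix n} → IsUnipotentUpper u → ∀ (x : Fin n → Carrier) →
                        (∀ i → sum (λ l → u i l * x l) ≈ 0#) → ∀ i → x i ≈ 0#
  unipotent-injective {zero}  u∈ x ux≈0 ()
  unipotent-injective {suc n} {u} u∈ x ux≈0 = λ where
      zero    → trans (sym (firstRow-sum {u = u} u∈ x tail≈0)) (ux≈0 zero)
      (suc i) → tail≈0 i
    where
    tail≈0 : ∀ i → x (suc i) ≈ 0#
    tail≈0 = unipotent-injective (minor-unipotent {x = u} u∈) (x ∘ suc)
      λ i → trans (sym (lowerRow-sum {u = u} u∈ i x)) (ux≈0 (suc i))

  unipotent-∙ : ∀ {n} {u w : Matrix n} → IsUnipotentUpper u → IsUnipotentUpper w → IsUnipotentUpper (u *ₘ w)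
  unipotent-∙ {zero}  _  _  = (λ ()) , λ ()
  unipotent-∙ {suc n} {u} {w} u∈ w∈ = block-unipotent
    (trans (firstRow-sum {u = u} u∈ (λ l → w l zero) w₊≈0) (proj₁ w∈ zero))
    (λ i → trans (lowerRow-sum {u = u} u∈ i (λ l → w l zero))
      (sum-zero (λ l → u (suc i) (suc l) * w (suc l) zero) λ l → trans (*-congˡ (w₊≈0 l)) (zeroʳ _)))
    (unipotent-resp (λ i j → sym (lowerRow-sum {u = u} u∈ i (λ l → w l (suc j))))
      (unipotent-∙ (minor-unipotent {x = u} u∈) (minor-unipotent {x = w} w∈)))
    where
    w₊≈0 : ∀ l → w (suc l) zero ≈ 0#
    w₊≈0 l = proj₂ w∈ (suc l) zero (ℕ.s≤s ℕ.z≤n)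

  -- The lower part of the first column of `w` is killed by the minor of `u`, which is injective;
  -- the minors are handled by induction. This yields closure of U under inverses without a formula
  -- for them.
  unipotent-cancelˡ : ∀ {n} {u w : Matrix n} → IsUnipotentUpper u → IsUnipotentUpper (u *ₘ w) → IsUnipotentUpper w
  unipotent-cancelˡ {zero}  _  _  = (λ ()) , λ ()
  unipotent-cancelˡ {suc n} {u} {w} u∈ uw∈ = block-unipotent
    (trans (sym (firstRow-sum {u = u} u∈ (λ l → w l zero) w₊≈0)) (proj₁ uw∈ zero))
    w₊≈0
    (unipotent-cancelˡ (minor-unipotent {x = u} u∈)
      (unipotent-resp (λ i j → lowerRow-sum {u = u} u∈ i (λ l → w l (suc j))) (minor-unipotent {x = u *ₘ w} uw∈)))
    where
    w₊≈0 : ∀ l → w (suc l) zero ≈ 0#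
    w₊≈0 = unipotent-injective (minor-unipotent {x = u} u∈) (λ l → w (suc l) zero)
      λ i → trans (sym (lowerRow-sum {u = u} u∈ i (λ l → w l zero))) (proj₂ uw∈ (suc i) zero (ℕ.s≤s ℕ.z≤n))

  superdiagonalSum-cong : ∀ {m} {x y : Matrix (suc m)} → x ≈ₘ y → superdiagonalSum x ≈ superdiagonalSum y
  superdiagonalSum-cong x≈y = sum-cong-≋ λ i → x≈y (inject₁ i) (suc i)

  -- In (uw)ᵢ,ᵢ₊₁ only the two terms with a diagonal factor 1 survive, so superdiagonal entries add.
  -- Hence `ψᵁ` is a character of U.
  superdiagonalSum-∙ : ∀ {m} {u w : Matrix (suc m)} → IsUnipotentUpper u → IsUnipotentUpper w →
                       superdiagonalSum (u *ₘ w) ≈ superdiagonalSum u + superdiagonalSum w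
  superdiagonalSum-∙ {zero}  _ _ = sym (+-identityˡ 0#)
  superdiagonalSum-∙ {suc m} {u} {w} u∈ w∈ = trans
    (+-cong entry (trans
      (superdiagonalSum-cong {x = minor (u *ₘ w)} {y = minor u *ₘ minor w} (λ i j → lowerRow-sum {u = u} u∈ i (λ l → w l (suc j))))
      (superdiagonalSum-∙ (minor-unipotent {x = u} u∈) (minor-unipotent {x = w} w∈))))
    (interchange _ _ _ _)
    where
    entry : (u *ₘ w) zero (suc zero) ≈ u zero (suc zero) + w zero (suc zero)
    entry = trans
      (+-cong (trans (*-congʳ (proj₁ u∈ zero)) (*-identityˡ _))
        (trans (+-cong (trans (*-congˡ (proj₁ w∈ (suc zero))) (*-identityʳ _))
                       (sum-zero (λ l → u zero (suc (suc l)) * w (suc (suc l)) (suc zero)) λ l →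
                         trans (*-congˡ (proj₂ w∈ (suc (suc l)) (suc zero) (ℕ.s≤s (ℕ.s≤s ℕ.z≤n)))) (zeroʳ _)))
               (+-identityʳ _)))
      (+-comm _ _)

  superdiagonalSum-1ₘ : ∀ {m} → superdiagonalSum (1ₘ {suc m}) ≈ 0#
  superdiagonalSum-1ₘ {m} = sum-zero {m} (λ i → 1ₘ (inject₁ i) (suc i)) 1ₘ-superdiagonal
    where
    1ₘ-superdiagonal : ∀ {m} (i : Fin m) → 1ₘ (inject₁ i) (suc i) ≈ 0#
    1ₘ-superdiagonal zero    = refl
    1ₘ-superdiagonal (suc i) = 1ₘ-superdiagonal i

-- Two naturality squares are glued over `V`. An identity between images in `V` thus carries the
-- action of `z` from `U` to `U′` without any map between them.
centre-transport : ∀ {n p} {F : PAdicField p} {R : CRing} → let open LinearGroups F; open Representations F in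
  {L : LinearGroup n} (z : NatEnd R L) {U U′ V : SmoothRep R L 0ℓ}
  (f : RepHom U V) (g : RepHom U′ V) {x : SmoothRep.Carrierᴹ U} {y : SmoothRep.Carrierᴹ U′} →
  SmoothRep._≈ᴹ_ V (RepHom.⟦_⟧ f x) (RepHom.⟦_⟧ g y) →
  SmoothRep._≈ᴹ_ V (RepHom.⟦_⟧ f (NatEnd._⟪_⟫ z U x)) (RepHom.⟦_⟧ g (NatEnd._⟪_⟫ z U′ y))
centre-transport {F = F} z {V = V} f g fx≈gy = ≈ᴹ-trans (natural f _)
  (≈ᴹ-trans (⟦⟧-cong (at V) fx≈gy) (≈ᴹ-sym (natural g _)))
  where
  open Representations F
  open NatEnd z
  open RepHom
  open SmoothRep V

module _ {p : ℕ} (F : PAdicField p) (W : CRing) (χ : AdditiveCharacter F W) (m : ℕ) where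
  open Whittaker F W χ m

  -- The function on P supported on U·K with value 1 at the identity

  module Bump (em : ExcludedMiddle 1ℓ) (B : Algebra W) where
    private
      module F = PAdicField F
      module W = CommutativeRing W
      module B = Algebra B
    open Classical em
    open Congruence F using (∼-sum; ∼-∈𝔭)
    open AdditiveCharacter χ
    open LinearGroup Pₙ
    open GroupProps group using (//-rightDividesʳ; \\-leftDividesʳ)
    open Unipotent F
    open CongruenceSubgroup F

    -- The level at which `ψ` becomes trivial may be a negative integer; its absolute value is a
    -- natural number at least as large.
    N : ℕ
    N = ℤ.∣ proj₁ smooth ∣

    private
      K′ : Pred Elem 0ℓ
      K′ = K m N

    ψ-trivial : ∀ {x} → x F.∈𝔭^ + suc N → ψ x W.≈ W.1#
    ψ-trivial x∈ = proj₂ smooth _ (F.∈𝔭-mono (ℤₚ.≤-trans (i≤∣i∣ (proj₁ smooth)) (ℤ.+≤+ (ℕₚ.n≤1+n N))) x∈)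
      where
      i≤∣i∣ : ∀ i → i ℤ.≤ + ℤ.∣ i ∣
      i≤∣i∣ (+ n)    = ℤₚ.≤-refl
      i≤∣i∣ -[1+ n ] = ℤ.-≤+

    ψᵁ-K : ∀ {k} → k ∈ K′ → ψᵁ (matrix k) W.≈ W.1#
    ψᵁ-K {k} k∈ = ψ-trivial (∼-∈𝔭
      (∼-sum (λ i → matrix k (inject₁ i) (suc i)) (λ i → 1ₘ (inject₁ i) (suc i)) λ i → k∈ (inject₁ i) (suc i))
      (F.0∈𝔭 (superdiagonalSum-1ₘ {m})))

    ψᵁ-∙ : ∀ {u w : Matrix (suc m)} → IsUnipotentUpper u → IsUnipotentUpper w → ψᵁ (u *ₘ w) W.≈ ψᵁ u W.* ψᵁ w
    ψᵁ-∙ {u} {w} u∈ w∈ = W.trans (ψ-cong (superdiagonalSum-∙ {u = u} {w} u∈ w∈)) (ψ-+ _ _)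

    U-∙ : ∀ {u w} → u ∈ IsU Pₙ → w ∈ IsU Pₙ → u ∙ w ∈ IsU Pₙ
    U-∙ {u} {w} u∈ w∈ = unipotent-∙ {u = matrix u} {matrix w} u∈ w∈

    U-⁻¹ : ∀ {u} → u ∈ IsU Pₙ → u ⁻¹ ∈ IsU Pₙ
    U-⁻¹ {u} u∈ = unipotent-cancelˡ {u = matrix u} {matrix (u ⁻¹)} u∈
      (unipotent-resp {x = 1ₘ} {matrix u *ₘ matrix (u ⁻¹)}
        (≈ₘ-sym {x = matrix (u ∙ u ⁻¹)} {1ₘ} (inverseʳ u)) 1ₘ-unipotent)

    UK : Pred Elem 0ℓ
    UK g = ∃ λ u → ∃ λ k → u ∈ IsU Pₙ × k ∈ K′ × g ≈ᴳ u ∙ k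

    U-UK : ∀ {u g} → u ∈ IsU Pₙ → g ∈ UK → u ∙ g ∈ UK
    U-UK {u} {g} u∈ (w , k , w∈ , k∈ , g≈wk) =
      u ∙ w , k , U-∙ {u} {w} u∈ w∈ , k∈ ,
      transᴳ {u ∙ g} {u ∙ (w ∙ k)} {(u ∙ w) ∙ k} (∙-congˡ {u} {g} {w ∙ k} g≈wk)
        (symᴳ {(u ∙ w) ∙ k} {u ∙ (w ∙ k)} (assoc u w k))

    UK-K : ∀ {g k} → k ∈ K′ → g ∈ UK → g ∙ k ∈ UK
    UK-K {g} {k} k∈ (w , l , w∈ , l∈ , g≈wl) =
      w , l ∙ k , w∈ , K-∙ m N {l} {k} l∈ k∈ ,
      transᴳ {g ∙ k} {(w ∙ l) ∙ k} {w ∙ (l ∙ k)} (∙-congʳ {k} {g} {w ∙ l} g≈wl) (assoc w l k)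

    UK-resp : ∀ {g h} → g ≈ᴳ h → g ∈ UK → h ∈ UK
    UK-resp {g} {h} g≈h (w , k , w∈ , k∈ , g≈wk) =
      w , k , w∈ , k∈ , transᴳ {h} {g} {w ∙ k} (symᴳ {g} {h} g≈h) g≈wk

    -- The decision is an argument, so that later lemmas can match on it. The decomposition it
    -- carries is an arbitrary choice, harmless by `value-unique`.
    value : ∀ g → Dec (g ∈ UK) → B.Carrier
    value g (yes (u , _)) = B.η (ψᵁ (matrix u))
    value g (no _)        = B.0#

    -- Two decompositions differ by an element of U ∩ K, on which ψ is trivial.
    value-unique : ∀ {g u k u′ k′} → u ∈ IsU Pₙ → k ∈ K′ → u′ ∈ IsU Pₙ → k′ ∈ K′ →
                   g ≈ᴳ u ∙ k → g ≈ᴳ u′ ∙ k′ → ψᵁ (matrix u) W.≈ ψᵁ (matrix u′)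
    value-unique {g} {u} {k} {u′} {k′} u∈ k∈ u′∈ k′∈ g≈uk g≈u′k′ = W.trans
      (ψ-cong (superdiagonalSum-cong {x = matrix u} {matrix u′ *ₘ matrix d} (symᴳ {u′ ∙ d} {u} u′d≈u)))
      (W.trans (ψᵁ-∙ {matrix u′} {matrix d} u′∈ d∈U)
        (W.trans (W.*-congˡ (ψᵁ-K {d} (K-∙ m N {k′} {k ⁻¹} k′∈ (K-⁻¹ m N {k} k∈)))) (W.*-identityʳ _)))
      where
      d : Elem
      d = k′ ∙ k ⁻¹
      u′d≈u : u′ ∙ d ≈ᴳ u
      u′d≈u = transᴳ {u′ ∙ d} {(u′ ∙ k′) ∙ k ⁻¹} {u}
        (symᴳ {(u′ ∙ k′) ∙ k ⁻¹} {u′ ∙ d} (assoc u′ k′ (k ⁻¹)))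
        (transᴳ {(u′ ∙ k′) ∙ k ⁻¹} {(u ∙ k) ∙ k ⁻¹} {u}
          (∙-congʳ {k ⁻¹} {u′ ∙ k′} {u ∙ k} (transᴳ {u′ ∙ k′} {g} {u ∙ k} (symᴳ {g} {u′ ∙ k′} g≈u′k′) g≈uk))
          (//-rightDividesʳ k u))
      d∈U : d ∈ IsU Pₙ
      d∈U = unipotent-cancelˡ {u = matrix u′} {matrix d} u′∈
        (unipotent-resp {x = matrix u} {matrix u′ *ₘ matrix d} (symᴳ {u′ ∙ d} {u} u′d≈u) u∈)

    value-UK : ∀ g (g? : Dec (g ∈ UK)) ((u , _) : g ∈ UK) → value g g? B.≈ B.η (ψᵁ (matrix u))
    value-UK g (yes (u , k , u∈ , k∈ , g≈uk)) (u′ , k′ , u′∈ , k′∈ , g≈u′k′) =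
      B.η-cong (value-unique {g} {u} {k} {u′} {k′} u∈ k∈ u′∈ k′∈ g≈uk g≈u′k′)
    value-UK g (no g∉) g∈ = contradiction g∈ g∉

    value-∉UK : ∀ g (g? : Dec (g ∈ UK)) → ¬ g ∈ UK → value g g? B.≈ B.0#
    value-∉UK g (yes g∈) g∉ = contradiction g∈ g∉
    value-∉UK g (no _)   _  = B.refl

    value-cong : ∀ {g h} (g? : Dec (g ∈ UK)) (h? : Dec (h ∈ UK)) → g ≈ᴳ h → value g g? B.≈ value h h?
    value-cong {g} {h} (yes g∈) h? g≈h = B.sym (value-UK h h? (UK-resp {g} {h} g≈h g∈))
    value-cong {g} {h} (no g∉)  h? g≈h = B.sym (value-∉UK h h? (g∉ ∘ UK-resp {h} {g} (symᴳ {g} {h} g≈h)))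

    value-U : ∀ {u g} (ug? : Dec (u ∙ g ∈ UK)) (g? : Dec (g ∈ UK)) → u ∈ IsU Pₙ →
              value (u ∙ g) ug? B.≈ B.η (ψᵁ (matrix u)) B.* value g g?
    value-U {u} {g} ug? (yes g∈@(w , _ , w∈ , _)) u∈ = B.trans (value-UK (u ∙ g) ug? (U-UK {u} {g} u∈ g∈))
      (B.trans (B.η-cong (ψᵁ-∙ {matrix u} {matrix w} u∈ w∈)) (B.η-* _ _))
    value-U {u} {g} ug? (no g∉) u∈ = B.trans
      (value-∉UK (u ∙ g) ug? λ ug∈ → g∉ (UK-resp {u ⁻¹ ∙ (u ∙ g)} {g} (\\-leftDividesʳ u g)
        (U-UK {u ⁻¹} {u ∙ g} (U-⁻¹ {u} u∈) ug∈)))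
      (B.sym (B.zeroʳ _))

    value-K : ∀ {g k} (gk? : Dec (g ∙ k ∈ UK)) (g? : Dec (g ∈ UK)) → k ∈ K′ → value (g ∙ k) gk? B.≈ value g g?
    value-K {g} {k} gk? (yes g∈) k∈ = value-UK (g ∙ k) gk? (UK-K {g} {k} k∈ g∈)
    value-K {g} {k} gk? (no g∉)  k∈ = value-∉UK (g ∙ k) gk? λ gk∈ →
      g∉ (UK-resp {(g ∙ k) ∙ k ⁻¹} {g} (//-rightDividesʳ k g) (UK-K {g ∙ k} {k ⁻¹} (K-⁻¹ m N {k} k∈) gk∈))

    bumpFun : Elem → B.Carrier
    bumpFun g = value g (decide (g ∈ UK))

    bumpFun-cong : ∀ {g h} → g ≈ᴳ h → bumpFun g B.≈ bumpFun h
    bumpFun-cong {g} {h} = value-cong {g} {h} (decide (g ∈ UK)) (decide (h ∈ UK))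

    -- Modulo U the set U·K has the same image as K: sets stable under U that cover K already cover
    -- U·K.
    UK-compact : IsCompactModulo (IsU Pₙ) UK
    UK-compact O O-open U-stable O-covers =
      proj₁ finite , λ g (u , k , u∈ , k∈ , g≈uk) → Any.map (translate u k g u∈ g≈uk) (proj₂ finite k k∈)
      where
      K-covered : ∀ k → k ∈ K′ → ∃ λ i → k ∈ O i
      K-covered k k∈ = O-covers k (ε , k , 1ₘ-unipotent , k∈ , symᴳ {ε ∙ k} {k} (identityˡ k))

      finite : ∃ λ is → ∀ k → k ∈ K′ → Any (λ i → k ∈ O i) is
      finite = K-compact m N {IsU Pₙ} em O O-open U-stable K-covered

      translate : ∀ u k g {i} → u ∈ IsU Pₙ → g ≈ᴳ u ∙ k → k ∈ O i → g ∈ O i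
      translate u k g {i} u∈ g≈uk k∈ =
        open-resp {O i} (O-open i) {u ∙ k} {g} (symᴳ {g} {u ∙ k} g≈uk) (U-stable i u k u∈ k∈)

    bump : c-IndFun Pₙ B (regular B.ring)
    bump = record
      { fun         = bumpFun
      ; fun-cong    = λ {g} {h} → bumpFun-cong {g} {h}
      ; equivariant = λ u g → value-U {u} {g} (decide (u ∙ g ∈ UK)) (decide (g ∈ UK))
      -- The stabiliser is stable under right translation by the open subgroup `K`, by `value-K`.
      ; smooth      = open-if-stable (K-open m N) (ε∈K m N)
          (λ {k} {l} k≈l s g → B.trans (bumpFun-cong (∙-congˡ {g} {l} {k} (symᴳ {k} {l} k≈l))) (s g))
          (λ k l s l∈ g → B.trans (bumpFun-cong (symᴳ {(g ∙ k) ∙ l} {g ∙ (k ∙ l)} (assoc g k l)))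
            (B.trans (value-K {g ∙ k} {l} (decide ((g ∙ k) ∙ l ∈ UK)) (decide (g ∙ k ∈ UK)) l∈) (s g))) } ,
      UK , UK-compact , λ g → value-∉UK g (decide (g ∈ UK))

    bump-ε : bumpFun ε B.≈ B.1#
    bump-ε = B.trans
      (value-UK ε (decide (ε ∈ UK)) (ε , ε , 1ₘ-unipotent , ε∈K m N , symᴳ {ε ∙ ε} {ε} (identityˡ ε)))
      (B.trans (B.η-cong (W.trans (ψ-cong (superdiagonalSum-1ₘ {m})) ψ-0)) B.η-1#)

  -- The Whittaker map and the coefficient inclusion over `W`

  IndW : (A : Algebra W) → SmoothRep W Gₙ 0ℓ
  IndW A = restrictRep A (Ind Gₙ A (regular (Algebra.ring A)))

  whittakerHom : (A : Algebra W) (V : SmoothRep (Algebra.ring A) Gₙ 0ℓ)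
                 (f : LinearIso (V⁽ⁿ⁾ A V) (regular (Algebra.ring A))) →
                 RepHom (restrictRep A V) (IndW A)
  whittakerHom A V f = record
    { linear = mkLinearMap _ _ (whittaker A V f)
        (λ x≈y g → f.⟦⟧-cong (≈⇒≈ψ A V (V.•-cong (λ _ _ → PAdicField.refl F) x≈y)))
        (λ x y g → A.trans (f.⟦⟧-cong (≈⇒≈ψ A V (V.•-+ g x y))) (f.+ᴹ-homo _ _))
        (λ w x g → A.trans (f.⟦⟧-cong (≈⇒≈ψ A V (V.•-*ₗ g _ x))) (f.*ₗ-homo _ _))
    ; equivariant = λ g x h → f.⟦⟧-cong (≈⇒≈ψ A V (V.≈ᴹ-sym (V.•-∙ h g x))) }
    where
    module A = Algebra A
    module f = LinearIso f
    module V = SmoothRep V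

  -- The two sides are modules over different rings; after restriction to `W` the inclusion becomes
  -- a morphism along which elements of the centre are natural.
  inclusionHom : {A : Algebra W} (A′ : Subalgebra A) → RepHom (IndW (Subalgebra.algebra A′)) (IndW A)
  inclusionHom {A} A′ = record
    { linear = mkLinearMap _ _
        (Ind-map Gₙ (Subalgebra.algebra A′) (regular (Subalgebra.subring A′)) A (regular (Algebra.ring A)) (inclusion A′))
        (λ e → e) (λ _ _ _ → A.refl) (λ _ _ _ → A.refl)
    ; equivariant = λ _ _ _ → A.refl }
    where module A = Algebra A

  -- Scalars by which the centre acts on V

  module _ (em : ExcludedMiddle 1ℓ) (A : Algebra W) (V : SmoothRep (Algebra.ring A) Gₙ 0ℓ)
           (f : LinearIso (V⁽ⁿ⁾ A V) (regular (Algebra.ring A))) (A′ : Subalgebra A)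
           (β : BernsteinZelevinskyMap A V) (image : ImageContained A V f A′ β) where
    private
      module A  = Algebra A
      module A′ = Subalgebra A′
      module V  = SmoothRep V
      module f  = LinearIso f
      module β  = BernsteinZelevinskyMap β
    open Bump em A′.algebra using (bump; bump-ε)
    open LinearGroup Gₙ using (ε)
    open IndFun using (fun)

    bumpImage : V.Carrierᴹ
    bumpImage = RepHom.⟦_⟧ β.map
      (c-Ind-map Pₙ A (regular A.ring) A (V⁽ⁿ⁾ A V) (restrictLinear A f.inverse)
        (c-Ind-map Pₙ A′.algebra (regular A′.subring) A (regular A.ring) (inclusion A′) bump))

    -- The Bernstein-Zelevinsky map sends a function into the class of its value at 1, here the
    -- preimage of 1 under `f`.
    bumpImage-class : f.⟦ bumpImage ⟧ A.≈ A.1#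
    bumpImage-class = A.trans (f.⟦⟧-cong (β.inducesIdentity _)) (A.trans (f.inverse-≈ _) bump-ε)

    scalar∈A′ : ∀ z a → (∀ x → NatEnd._⟪_⟫ z (restrictRep A V) x V.≈ᴹ a V.*ₗ x) → a ∈ A′.member
    scalar∈A′ z a acts =
      let h , w≈h = ImageContained.contained image bump
      in A′.resp
        (begin
          proj₁ (fun (NatEnd._⟪_⟫ z (IndW A′.algebra) h) ε)
            -- In Ind ψ_A the Whittaker function of `bumpImage` equals the image of `h`, so applying
            -- `z` on either side gives the same function, evaluated here at `ε`.
            ≈⟨ centre-transport z (whittakerHom A V f) (inclusionHom A′) {bumpImage} {h} w≈h ε ⟨
          f.⟦ ε V.• NatEnd._⟪_⟫ z (restrictRep A V) bumpImage ⟧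
            ≈⟨ f.⟦⟧-cong (≈⇒≈ψ A V (V.≈ᴹ-trans (V.•-ε _) (acts bumpImage))) ⟩
          f.⟦ a V.*ₗ bumpImage ⟧
            ≈⟨ f.*ₗ-homo a bumpImage ⟩
          a A.* f.⟦ bumpImage ⟧
            ≈⟨ A.*-congˡ bumpImage-class ⟩
          a A.* A.1#
            ≈⟨ A.*-identityʳ a ⟩
          a ∎)
        -- Since `z` preserves Ind ψ_A′, the value at `ε` carries its own proof of membership.
        (proj₂ (fun (NatEnd._⟪_⟫ z (IndW A′.algebra) h) ε))
      where open SetoidReasoning A.setoid

theorem3p2 : ExcludedMiddle 1ℓ →
    (p ℓ : ℕ) → Prime p → Prime ℓ → ℓ ≢ p →
    (F : PAdicField p) (k : AlgebraicallyClosedField ℓ) (Wk : WittVectors ℓ k) →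
    let W = WittVectors.ring Wk in
    (χ : AdditiveCharacter F W) (m : ℕ) →
    let open Whittaker F W χ m in
    (A : Algebra W) (e : ∣ Zₙ ∣) (e-primitive : IsPrimitiveIdempotent Zₙ e) →
    let eZₙ = blockCentre e e-primitive in
    (V : SmoothRep (Algebra.ring A) Gₙ 0ℓ) → CoWhittaker A V → InBlock A V e →
    (f : LinearIso (V⁽ⁿ⁾ A V) (regular (Algebra.ring A))) (A′ : Subalgebra A) →
    (β : BernsteinZelevinskyMap A V) → ImageContained A V f A′ β →
    (θ : RingHom eZₙ (Algebra.ring A)) → ActsThrough A V e e-primitive θ →
    FactorsThrough eZₙ A A′ θ
theorem3p2 em _ _ _ _ _ F k Wk χ m A e e-primitive V _ _ f A′ β image θ acts =
  record
    -- Equality in the subring is equality in `A`, so once the values lie in `A′` the homomorphism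
    -- laws of `θ` carry over unchanged.
    { ⟦_⟧ = λ z → θ.⟦ z ⟧ , scalar∈A′ F (WittVectors.ring Wk) χ m em A V f A′ β image (proj₁ z) θ.⟦ z ⟧ (acts z)
    ; isRingHomomorphism = record
      { isSemiringHomomorphism = record
        { isNearSemiringHomomorphism = record
          { +-isMonoidHomomorphism = record
            { isMagmaHomomorphism = record
              { isRelHomomorphism = record { cong = θ.⟦⟧-cong } ; homo = θ.+-homo }
            ; ε-homo = θ.0#-homo }
          ; *-homo = θ.*-homo }
        ; 1#-homo = θ.1#-homo }
      ; -‿homo = θ.-‿homo } } ,
  λ _ → A.refl
  where
  module A = Algebra A
  module θ = RingHomomorphism θ
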